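{- There exists a polynomial function $K:\mathbb{N}\to\mathbb{N}$ such that for every integer $\ell\ge 2$, every digraph $D$ with $\delta^+(D)\ge K(\ell)$ contains a subdivision of every orientation of $C_\ell$.
   Context: Digraphs are finite, loopless, without parallel arcs, but may contain digons (pairs of opposite arcs). $\delta^+(D)$ is the minimum out-degree of $D$. $C_\ell$ is the undirected cycle of length $\ell$; an orientation of an undirected simple graph replaces each edge $\{u,v\}$ by exactly one of the arcs $(u,v)$, $(v,u)$. A subdivision of a digraph $F$ is a digraph obtained by replacing every arc $(x,y)$ of $F$ by a directed path from $x$ to $y$, such that the paths corresponding to different arcs are internally vertex-disjoint; "$D$ contains a subdivision of $F$" means some subdigraph of $D$ is a subdivision of $F$. -}

module Defs where

open import Data.Nat using (ℕ; zero; suc; _+_; _*_; _≤_; _<_)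
open import Data.Nat.Properties using (_≟_)
open import Data.Fin using (Fin; zero; suc; toℕ; fromℕ; lower₁)
open import Data.Bool using (Bool; true; false; if_then_else_)
open import Data.List using (List; []; _∷_; _++_; [_]; length; filterᵇ; allFin)
open import Data.List.Membership.Propositional using (_∈_; _∉_)
open import Data.List.Relation.Unary.Linked using (Linked)
open import Data.List.Relation.Unary.Unique.Propositional using (Unique)
open import Data.Product using (_×_; _,_; proj₁; proj₂)
open import Relation.Binary.PropositionalEquality using (_≡_; _≢_)
open import Relation.Nullary using (yes; no)
open import Function.Definitions using (Injective)

evalPoly : List ℕ → ℕ → ℕ
evalPoly []       x = 0
evalPoly (c ∷ cs) x = c + x * evalPoly cs x

-- A finite digraph on vertex set Fin n: loopless, no parallel arcs
-- (arc relation is a Bool-valued relation), digons allowed.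
record Digraph : Set where
  field
    n        : ℕ
    arc      : Fin n → Fin n → Bool
    loopless : ∀ v → arc v v ≡ false
open Digraph public

outdeg : (D : Digraph) → Fin (n D) → ℕ
outdeg D v = length (filterᵇ (arc D v) (allFin (n D)))

minOutDeg≥ : Digraph → ℕ → Set
minOutDeg≥ D d = ∀ v → d ≤ outdeg D v

IsDiPath : (D : Digraph) → List (Fin (n D)) → Set
IsDiPath D vs = Linked (λ x y → arc D x y ≡ true) vs × Unique vs

-- A pattern digraph (possibly with parallel arcs, needed for C₂):
-- k vertices, m arcs with tail/head maps.
record Pattern : Set where
  field
    k    : ℕ
    m    : ℕ
    tail : Fin m → Fin k
    head : Fin m → Fin k
open Pattern public

next : ∀ {ℓ} → Fin ℓ → Fin ℓ
next {suc ℓ} i with toℕ i ≟ ℓ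
... | yes _  = zero
... | no  ne = lower₁ (suc i) (λ e → ne (Data.Nat.Properties.suc-injective (Relation.Binary.PropositionalEquality.sym e)))

orientedCycle : (ℓ : ℕ) → (Fin ℓ → Bool) → Pattern
orientedCycle ℓ o = record
  { k = ℓ ; m = ℓ
  ; tail = λ i → if o i then i else next i
  ; head = λ i → if o i then next i else i }

record ContainsSubdivision (D : Digraph) (F : Pattern) : Set where
  field
    φ      : Fin (k F) → Fin (n D)
    φ-inj  : Injective _≡_ _≡_ φ
    inner  : Fin (m F) → List (Fin (n D))
  walk : Fin (m F) → List (Fin (n D))
  walk a = φ (tail F a) ∷ inner a ++ [ φ (head F a) ]
  field
    isPath    : ∀ a → IsDiPath D (walk a)
    avoidsBranch : ∀ a v → v ∈ inner a → ∀ x → φ x ≢ v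
    internallyDisjoint : ∀ a b → a ≢ b → ∀ v → v ∈ inner a → v ∉ inner b
    -- distinct arcs of F use distinct paths (rules out two parallel
    -- pattern arcs both realised by the same single arc of D)
    distinctPaths : ∀ a b → a ≢ b → walk a ≢ walk b

{-# OPTIONS --safe #-}

-- A constant orientation only needs a long directed cycle. Any other orientation consists of k
-- sources and k sinks joined by 2k blocks, and it suffices to realise every block by a directed
-- path with at least 2ℓ inner vertices.
--
-- Induct on |A| over pairs (A , B) such that all arcs leaving A end in A ∪ B and |B| ≤ w. Inside A
-- we find a set W of at most w/2 vertices carrying all sources, all blocks not incident with one
-- particular sink, and two pendant legs with tips e and f that still have to meet in that sink.
-- If some path from e meets some path from f outside W, the cycle closes. Otherwise the sets reached
-- from e and from f in D − W are disjoint, so one of them contains at most half of B; its trace on A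
-- is smaller than A and has at most |W| + w/2 ≤ w out-neighbours, and induction applies.
--
-- To find W, take a maximum family of disjoint spiders (a center with three disjoint legs of 2ℓ
-- vertices) in A, and greedily grow a new spider at each leg end. At most one attempt per spider
-- succeeds, since two new spiders would replace the old one in a larger family. Hence every spider
-- has two legs extending to dead tips, whose K − w or more out-neighbours in A all lie in the
-- vertices used so far. There are only O(ℓ) of these per spider, so spiders and their out-neighbours
-- form a dense bipartite graph, in which source, sink, source, … can be chosen greedily with the
-- sinks and spiders in pairwise different territories.

module Submission where

open import Defs
open import Algebra.Properties.CommutativeSemigroup using (x∙yz≈y∙xz)
import Algebra.Solver.CommutativeMonoid
open import Data.Bool as Bool using (Bool; true; false; not)
open import Data.Bool.Properties using (T-≡)
open import Data.Empty using (⊥-elim)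
open import Data.Fin as Fin using (Fin; zero; suc; toℕ; inject₁; fromℕ)
import Data.Fin.Properties as Fin
open import Data.List
  using (List; []; _∷_; [_]; _++_; _∷ʳ_; length; lookup; allFin; filter; filterᵇ; map; concatMap; replicate; tabulate)
import Data.List.Membership.DecPropositional as DecMembership
open import Data.List.Membership.Propositional using (_∈_; _∉_; find)
open import Data.List.Membership.Propositional.Properties
  using (∈-++⁺ˡ; ∈-++⁺ʳ; ∈-++⁻; ∈-∃++; ∈-filter⁺; ∈-filter⁻; ∈-allFin; ∈-lookup; ∈-concatMap⁺; ∈-concatMap⁻)
open import Data.List.Properties
  using (length-++; filter-notAll; ++-assoc; ++-identityʳ; length-replicate; length-tabulate; ∷ʳ-injective; ∷-injectiveʳ)
open import Data.List.Relation.Binary.Disjoint.Propositional using (Disjoint)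
open import Data.List.Relation.Binary.Permutation.Propositional
  using (_↭_; ↭⇒↭ₛ; ↭-refl; ↭-sym; ↭-trans; ↭-reflexive; prep; swap)
open import Data.List.Relation.Binary.Permutation.Propositional.Properties
  using (shift; shifts; ↭-length; ++⁺ˡ; ++⁺ʳ; ++-comm; ++-commutativeMonoid; ∈-resp-↭)
open import Data.List.Relation.Binary.Permutation.Setoid.Properties using (Unique-resp-↭)
open import Data.List.Relation.Binary.Subset.Propositional using (_⊆_)
open import Data.List.Relation.Unary.All as All using (All; []; _∷_)
open import Data.List.Relation.Unary.AllPairs as AllPairs using (AllPairs; []; _∷_)
open import Data.List.Relation.Unary.Any as Any using (Any; here; there)
open import Data.List.Relation.Unary.Any.Properties using (lookup-index)
open import Data.List.Relation.Unary.Linked using (Linked; [-]; _∷_)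
open import Data.List.Relation.Unary.Unique.Propositional using (Unique)
import Data.List.Relation.Unary.Unique.Propositional.Properties as Unique
open import Data.Nat using (ℕ; zero; suc; _+_; _*_; _≤_; _<_; z≤n; s≤s; _<?_; _≤?_)
open import Data.Nat.ListAction using (sum)
open import Data.Nat.Properties
open import Data.Nat.Tactic.RingSolver using (solve-∀)
open import Data.Product using (∃; ∃₂; ∃-syntax; _×_; _,_; proj₁; proj₂)
open import Data.Sum as Sum using (_⊎_; inj₁; inj₂; [_,_]′)
open import Function using (_∘_; id; Equivalence)
open import Relation.Binary.Definitions using (DecidableEquality)
open import Relation.Binary.PropositionalEquality hiding ([_])
open import Relation.Nullary using (¬_; yes; no; Dec; ¬?; contradiction; _×-dec_)
open import Relation.Unary using (Pred; Decidable)

-- Counting in duplicate-free lists.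

module _ {a} {X : Set a} where

  private variable
    x : X
    xs ys zs : List X

  unique-⊆⇒length≤ : Unique xs → xs ⊆ ys → length xs ≤ length ys
  unique-⊆⇒length≤ {[]} _ _ = z≤n
  unique-⊆⇒length≤ {x ∷ xs} {ys} u@(_ ∷ uxs) sub with as , bs , refl ← ∈-∃++ (sub (here refl)) =
    subst (suc (length xs) ≤_) eq (s≤s (unique-⊆⇒length≤ uxs sub′))
    where
    x∉xs : x ∉ xs
    x∉xs = Unique.Unique[x∷xs]⇒x∉xs u
    sub′ : xs ⊆ as ++ bs
    sub′ v∈ with ∈-++⁻ as (sub (there v∈))
    ... | inj₁ v∈as = ∈-++⁺ˡ v∈as
    ... | inj₂ (here refl) = ⊥-elim (x∉xs v∈)
    ... | inj₂ (there v∈bs) = ∈-++⁺ʳ as v∈bs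
    eq : suc (length (as ++ bs)) ≡ length (as ++ x ∷ bs)
    eq = trans (cong suc (length-++ as)) (trans (sym (+-suc (length as) _)) (sym (length-++ as)))

  unique-++⁻ : ∀ xs → Unique (xs ++ ys) → Unique xs × Unique ys × Disjoint xs ys
  unique-++⁻ [] u = [] , u , λ ()
  unique-++⁻ (x ∷ xs) (px ∷ u) with uxs , uys , d ← unique-++⁻ xs u =
    All.tabulate (λ v∈ → All.lookup px (∈-++⁺ˡ v∈)) ∷ uxs , uys ,
    λ where (here refl , v∈ys) → All.lookup px (∈-++⁺ʳ xs v∈ys) refl
            (there v∈xs , v∈ys) → d (v∈xs , v∈ys)

  module _ {p} {P : Pred X p} (P? : Decidable P) where

    length-filter-∁ : ∀ xs → length (filter P? xs) + length (filter (¬? ∘ P?) xs) ≡ length xs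
    length-filter-∁ [] = refl
    length-filter-∁ (x ∷ xs) with P? x
    ... | yes _ = cong suc (length-filter-∁ xs)
    ... | no _ = trans (+-suc _ _) (cong suc (length-filter-∁ xs))

    length-filter-disjoint : ∀ {q} {Q : Pred X q} (Q? : Decidable Q) →
      (∀ {x} → P x → ¬ Q x) → ∀ xs → length (filter P? xs) + length (filter Q? xs) ≤ length xs
    length-filter-disjoint Q? pq [] = z≤n
    length-filter-disjoint Q? pq (x ∷ xs) with P? x | Q? x
    ... | yes p | yes q = ⊥-elim (pq p q)
    ... | yes p | no _ = s≤s (length-filter-disjoint Q? pq xs)
    ... | no _ | yes q = ≤-trans (≤-reflexive (+-suc _ _)) (s≤s (length-filter-disjoint Q? pq xs))
    ... | no _ | no _ = m≤n⇒m≤1+n (length-filter-disjoint Q? pq xs)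

  module _ (_≟_ : DecidableEquality X) where
    open DecMembership _≟_ using (_∈?_)

    pick-∉ : Unique xs → length ys < length xs → ∃ λ x → x ∈ xs × x ∉ ys
    pick-∉ {xs} {ys} u lt with Any.any? (λ x → ¬? (x ∈? ys)) xs
    ... | yes any = find any
    ... | no none = contradiction (unique-⊆⇒length≤ u sub) (<⇒≱ lt)
      where
      sub : xs ⊆ ys
      sub {x} x∈ with x ∈? ys
      ... | yes x∈ys = x∈ys
      ... | no x∉ys = ⊥-elim (none (Any.map (λ where refl → x∉ys) x∈))

  lengths-concatMap : ∀ {b} {Y : Set b} (f : Y → List X) c → (∀ y → length (f y) ≤ c) →
    ∀ ys → length (concatMap f ys) ≤ length ys * c
  lengths-concatMap f c le [] = z≤n
  lengths-concatMap f c le (y ∷ ys) = begin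
    length (f y ++ concatMap f ys) ≡⟨ length-++ (f y) ⟩
    length (f y) + length (concatMap f ys) ≤⟨ +-mono-≤ (le y) (lengths-concatMap f c le ys) ⟩
    c + length ys * c ∎
    where open ≤-Reasoning

module _ {a b r} {X : Set a} {Y : Set b} {R : X → Y → Set r} (R? : ∀ x y → Dec (R x y)) where

  private
    row : List Y → X → ℕ
    row ys x = length (filter (R? x) ys)
    col : List X → Y → ℕ
    col xs y = length (filter (λ x → R? x y) xs)

    row-∷ : ∀ x xs ys → row ys x + sum (map (col xs) ys) ≡ sum (map (col (x ∷ xs)) ys)
    row-∷ x xs [] = refl
    row-∷ x xs (y ∷ ys) with R? x y
    ... | yes _ = cong suc (trans (x∙yz≈y∙xz +-commutativeSemigroup (row ys x) (col xs y) (sum (map (col xs) ys))) (cong (col xs y +_) (row-∷ x xs ys)))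
    ... | no _ = trans (x∙yz≈y∙xz +-commutativeSemigroup (row ys x) (col xs y) (sum (map (col xs) ys))) (cong (col xs y +_) (row-∷ x xs ys))

    rows≤cols : ∀ p xs ys → (∀ {x} → x ∈ xs → p ≤ row ys x) → length xs * p ≤ sum (map (col xs) ys)
    rows≤cols p [] ys _ = z≤n
    rows≤cols p (x ∷ xs) ys le = begin
      p + length xs * p ≤⟨ +-mono-≤ (le (here refl)) (rows≤cols p xs ys (le ∘ there)) ⟩
      row ys x + sum (map (col xs) ys) ≡⟨ row-∷ x xs ys ⟩
      sum (map (col (x ∷ xs)) ys) ∎
      where open ≤-Reasoning

    cols≤ : ∀ q xs ys → (∀ {y} → y ∈ ys → col xs y ≤ q) → sum (map (col xs) ys) ≤ length ys * q
    cols≤ q xs [] _ = z≤n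
    cols≤ q xs (y ∷ ys) le = +-mono-≤ (le (here refl)) (cols≤ q xs ys (le ∘ there))

  -- The related pairs are counted once by rows and once by columns.
  double-count : ∀ {p q} xs ys →
    (∀ {x} → x ∈ xs → p ≤ length (filter (R? x) ys)) →
    (∀ {y} → y ∈ ys → length (filter (λ x → R? x y) xs) ≤ q) →
    length xs * p ≤ length ys * q
  double-count {p} {q} xs ys lo hi = ≤-trans (rows≤cols p xs ys lo) (cols≤ q xs ys hi)

unique-↭ : ∀ {a} {X : Set a} {xs ys : List X} → xs ↭ ys → Unique xs → Unique ys
unique-↭ {X = X} = Unique-resp-↭ (setoid X) ∘ ↭⇒↭ₛ

-- Walks, legs, and realisations of words of arc directions.

module Walks (D : Digraph) where

  V : Set
  V = Fin (n D)

  infix 4 _⇒_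
  _⇒_ : V → V → Set
  x ⇒ y = arc D x y ≡ true

  infix 4 _⇒?_
  _⇒?_ : ∀ x y → Dec (x ⇒ y)
  x ⇒? y = arc D x y Bool.≟ true

  open DecMembership (Fin._≟_ {n D}) using (_∈?_) public

  private variable
    x y z : V
    is js : List V

  -- Walk x is y: the list holds the interior vertices.
  data Walk : V → List V → V → Set where
    edge : x ⇒ y → Walk x [] y
    _∷_ : x ⇒ y → Walk y is z → Walk x (y ∷ is) z

  -- Leg x l y: the list omits the first vertex and keeps the last one, so l = [] forces x = y.
  data Leg : V → List V → V → Set where
    []  : Leg x [] x
    _∷_ : x ⇒ y → Leg y is z → Leg x (y ∷ is) z

  infixr 5 _++ᴸ_ _++ᵂ_ _▹_
  _++ᴸ_ : Leg x is y → Leg y js z → Leg x (is ++ js) z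
  [] ++ᴸ q = q
  (a ∷ p) ++ᴸ q = a ∷ (p ++ᴸ q)

  _++ᵂ_ : Leg x is y → Walk y js z → Walk x (is ++ js) z
  [] ++ᵂ q = q
  (a ∷ p) ++ᵂ q = a ∷ (p ++ᵂ q)

  _▹_ : Leg x is y → y ⇒ z → Walk x is z
  [] ▹ a = edge a
  (b ∷ p) ▹ a = b ∷ (p ▹ a)

  -- A leg lists its end, a walk does not. The empty leg has no last arc to split off, hence
  -- `x ≢ z`.
  unsnocᴸ : Leg x is z → x ≢ z → ∃ λ js → is ≡ js ∷ʳ z × Walk x js z
  unsnocᴸ [] ne = ⊥-elim (ne refl)
  unsnocᴸ (a ∷ []) ne = [] , refl , edge a
  unsnocᴸ (_∷_ {y = y} a (b ∷ p)) ne = go a b p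
    where
    go : ∀ {x y w z l} → x ⇒ y → y ⇒ w → Leg w l z → ∃ λ js → y ∷ w ∷ l ≡ js ∷ʳ z × Walk x js z
    go a b [] = _ , refl , a ∷ edge b
    go a b (c ∷ p) with js , eq , w ← go b c p = _ , cong (_ ∷_) eq , a ∷ w

  end∈leg : Leg x is z → z ∈ x ∷ is
  end∈leg [] = here refl
  end∈leg (a ∷ p) = there (end∈leg p)

  tip∈leg : Leg x is z → 0 < length is → z ∈ is
  tip∈leg (a ∷ p) _ = end∈leg p

  walk-linked : Walk x is y → Linked _⇒_ (x ∷ is ++ [ y ])
  walk-linked (edge a) = a ∷ [-]
  walk-linked (a ∷ w) = a ∷ walk-linked w

  Step : Bool → V → List V → V → Set
  Step true x is y = Walk x is y
  Step false x is y = Walk y is x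

  -- An oriented walk from x to z realising a word of arc directions, every letter by a directed
  -- walk; the vertex list contains x but not z. The interiors are nonempty so that distinct arcs
  -- of a parallel pair are automatically realised by distinct paths.
  data Real : List Bool → V → V → List V → Set where
    []   : ∀ {x} → Real [] x x []
    step : ∀ {b bs x y z i is vs} → Step b x (i ∷ is) y → Real bs y z vs →
           Real (b ∷ bs) x z (x ∷ i ∷ is ++ vs)

  private variable
    bs cs : List Bool
    vs us : List V

  infixr 5 _++ᴿ_
  _++ᴿ_ : Real bs x y vs → Real cs y z us → Real (bs ++ cs) x z (vs ++ us)
  [] ++ᴿ r = r
  _++ᴿ_ {us = us} (step {x = x} {i = i} {is = is} {vs = vs} s p) r =
    subst (λ l → Real _ x _ (x ∷ i ∷ l)) (sym (++-assoc is vs us)) (step s (p ++ᴿ r))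

  splitᴿ : ∀ bs → Real (bs ++ cs) x z vs →
           ∃ λ y → ∃₂ λ vs₁ vs₂ → Real bs x y vs₁ × Real cs y z vs₂ × vs ≡ vs₁ ++ vs₂
  splitᴿ [] r = _ , _ , _ , [] , r , refl
  splitᴿ (b ∷ bs) (step {i = i} {is = is} s r) with y , vs₁ , vs₂ , r₁ , r₂ , refl ← splitᴿ bs r =
    y , _ , vs₂ , step s r₁ , r₂ , cong (λ l → _ ∷ i ∷ l) (sym (++-assoc is vs₁ vs₂))

  -- Each letter but the last takes two interior vertices of the walk: one stays interior, the next
  -- becomes a branch vertex. The last letter takes all that is left, so longer walks serve as well.
  prepend-forward : ∀ p → suc (p + p) ≤ length is → Walk x is y → Real bs y z vs →
                    Real (replicate (suc p) true ++ bs) x z (x ∷ is ++ vs)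
  prepend-forward zero (s≤s le) w@(_ ∷ _) r = step w r
  prepend-forward (suc p) (s≤s (s≤s le)) (a ∷ b ∷ w) r =
    step {is = []} (a ∷ edge b) (prepend-forward p (≤-trans (≤-reflexive (sym (+-suc p p))) le) w r)

  replicate-∷ : ∀ {a} {X : Set a} k (x : X) xs → replicate k x ++ x ∷ xs ≡ x ∷ replicate k x ++ xs
  replicate-∷ zero x xs = refl
  replicate-∷ (suc k) x xs = cong (x ∷_) (replicate-∷ k x xs)

  -- The word is read against the walk, so arcs are peeled off the front of the walk and attached to
  -- the realisation as backward letters. This reverses the order of the vertices, whence only a
  -- permutation.
  prepend-backward : ∀ p → suc (p + p) ≤ length is → Walk x is y → Real bs x z vs →
                     ∃ λ us → Real (replicate (suc p) false ++ bs) y z us × us ↭ y ∷ is ++ vs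
  prepend-backward zero (s≤s le) w@(_ ∷ _) r = _ , step w r , ↭-refl
  prepend-backward {y = y} {bs = bs} {z = z} {vs = vs} (suc p) (s≤s (s≤s le)) (_∷_ {y = i₁} a (_∷_ {y = i₂} {is = is} b w)) r
    with us , r′ , perm ← prepend-backward p (≤-trans (≤-reflexive (sym (+-suc p p))) le) w
           (step {b = false} {is = []} (a ∷ edge b) r) =
    us , subst (λ bs → Real bs y z us) (cong (false ∷_) (replicate-∷ p false bs)) r′ ,
    ↭-trans perm (prep y (↭-trans (shift i₂ is (i₁ ∷ vs)) (↭-trans (prep i₂ (shift i₁ is vs))
      (swap i₂ i₁ ↭-refl))))

  -- Cutting a closed realisation in two and exchanging the pieces only permutes its vertices.
  rotateᴿ : ∀ bs cs → Real (bs ++ cs) x x vs → Unique vs →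
            ∃₂ λ y us → Real (cs ++ bs) y y us × Unique us
  rotateᴿ bs cs r u with y , vs₁ , vs₂ , r₁ , r₂ , refl ← splitᴿ bs r =
    y , _ , r₂ ++ᴿ r₁ , unique-↭ (++-comm vs₁ vs₂) u

  -- Index `ℓ` is kept besides index 0 because an oriented walk need not be closed; on a closed one
  -- both give the same branch vertex.
  vertex : ∀ {ℓ} (f : Fin ℓ → Bool) → Real (tabulate f) x z vs → Fin (suc ℓ) → V
  vertex {x = x} f r zero = x
  vertex {ℓ = suc ℓ} f (step s r) (suc i) = vertex (f ∘ suc) r i

  inside : ∀ {ℓ} (f : Fin ℓ → Bool) → Real (tabulate f) x z vs → Fin ℓ → List V
  inside f (step {i = i} {is = is} s r) zero = i ∷ is
  inside f (step s r) (suc j) = inside (f ∘ suc) r j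

  vertex-last : ∀ {ℓ} (f : Fin ℓ → Bool) (r : Real (tabulate f) x z vs) → vertex f r (fromℕ ℓ) ≡ z
  vertex-last {ℓ = zero} f [] = refl
  vertex-last {ℓ = suc ℓ} f (step s r) = vertex-last (f ∘ suc) r

  step-at : ∀ {ℓ} (f : Fin ℓ → Bool) (r : Real (tabulate f) x z vs) i →
            Step (f i) (vertex f r (inject₁ i)) (inside f r i) (vertex f r (suc i))
  step-at f (step s r) zero = s
  step-at f (step s r) (suc i) = step-at (f ∘ suc) r i

  inside-nonempty : ∀ {ℓ} (f : Fin ℓ → Bool) (r : Real (tabulate f) x z vs) i → ∃ λ v → v ∈ inside f r i
  inside-nonempty f (step s r) zero = _ , here refl
  inside-nonempty f (step s r) (suc i) = inside-nonempty (f ∘ suc) r i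

  vertex∈ : ∀ {ℓ} (f : Fin ℓ → Bool) (r : Real (tabulate f) x z vs) i → vertex f r (inject₁ i) ∈ vs
  vertex∈ f (step s r) zero = here refl
  vertex∈ f (step {is = is} s r) (suc i) = there (there (∈-++⁺ʳ is (vertex∈ (f ∘ suc) r i)))

  inside⊆ : ∀ {ℓ} (f : Fin ℓ → Bool) (r : Real (tabulate f) x z vs) i → inside f r i ⊆ vs
  inside⊆ f (step {is = is} s r) zero v∈ = there (∈-++⁺ˡ v∈)
  inside⊆ f (step {is = is} s r) (suc i) v∈ = there (there (∈-++⁺ʳ is (inside⊆ (f ∘ suc) r i v∈)))

  vertex-injective : ∀ {ℓ} (f : Fin ℓ → Bool) (r : Real (tabulate f) x z vs) → Unique vs →
                     ∀ i j → vertex f r (inject₁ i) ≡ vertex f r (inject₁ j) → i ≡ j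
  vertex-injective f (step s r) u zero zero eq = refl
  vertex-injective f (step {is = is} s r) u zero (suc j) refl =
    ⊥-elim (Unique.Unique[x∷xs]⇒x∉xs u (there (∈-++⁺ʳ is (vertex∈ (f ∘ suc) r j))))
  vertex-injective f (step {is = is} s r) u (suc i) zero refl =
    ⊥-elim (Unique.Unique[x∷xs]⇒x∉xs u (there (∈-++⁺ʳ is (vertex∈ (f ∘ suc) r i))))
  vertex-injective f (step {i = i₀} {is = is} s r) (_ ∷ u) (suc i) (suc j) eq =
    cong suc (vertex-injective (f ∘ suc) r (proj₁ (proj₂ (unique-++⁻ (i₀ ∷ is) u))) i j eq)

  inside-unique : ∀ {ℓ} (f : Fin ℓ → Bool) (r : Real (tabulate f) x z vs) → Unique vs →
                  ∀ i → Unique (inside f r i)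
  inside-unique f (step {i = i₀} {is = is} s r) (_ ∷ u) zero = proj₁ (unique-++⁻ (i₀ ∷ is) u)
  inside-unique f (step {i = i₀} {is = is} s r) (_ ∷ u) (suc i) =
    inside-unique (f ∘ suc) r (proj₁ (proj₂ (unique-++⁻ (i₀ ∷ is) u))) i

  vertex∉inside : ∀ {ℓ} (f : Fin ℓ → Bool) (r : Real (tabulate f) x z vs) → Unique vs →
                  ∀ i j → vertex f r (inject₁ i) ∉ inside f r j
  vertex∉inside f (step s r) u zero zero v∈ = Unique.Unique[x∷xs]⇒x∉xs u (∈-++⁺ˡ v∈)
  vertex∉inside f (step {is = is} s r) u zero (suc j) v∈ =
    Unique.Unique[x∷xs]⇒x∉xs u (there (∈-++⁺ʳ is (inside⊆ (f ∘ suc) r j v∈)))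
  vertex∉inside f (step {i = i₀} {is = is} s r) (_ ∷ u) (suc i) zero v∈ =
    proj₂ (proj₂ (unique-++⁻ (i₀ ∷ is) u)) (v∈ , vertex∈ (f ∘ suc) r i)
  vertex∉inside f (step {i = i₀} {is = is} s r) (_ ∷ u) (suc i) (suc j) v∈ =
    vertex∉inside (f ∘ suc) r (proj₁ (proj₂ (unique-++⁻ (i₀ ∷ is) u))) i j v∈

  inside-disjoint : ∀ {ℓ} (f : Fin ℓ → Bool) (r : Real (tabulate f) x z vs) → Unique vs →
                    ∀ i j → i ≢ j → Disjoint (inside f r i) (inside f r j)
  inside-disjoint f (step s r) u zero zero ne _ = ne refl
  inside-disjoint f (step {i = i₀} {is = is} s r) (_ ∷ u) zero (suc j) ne (v∈ , v∈′) =
    proj₂ (proj₂ (unique-++⁻ (i₀ ∷ is) u)) (v∈ , inside⊆ (f ∘ suc) r j v∈′)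
  inside-disjoint f (step {i = i₀} {is = is} s r) (_ ∷ u) (suc i) zero ne (v∈ , v∈′) =
    proj₂ (proj₂ (unique-++⁻ (i₀ ∷ is) u)) (v∈′ , inside⊆ (f ∘ suc) r i v∈)
  inside-disjoint f (step {i = i₀} {is = is} s r) (_ ∷ u) (suc i) (suc j) ne =
    inside-disjoint (f ∘ suc) r (proj₁ (proj₂ (unique-++⁻ (i₀ ∷ is) u))) i j (ne ∘ cong suc)

  -- The index past the end gives the start vertex again, as the wrap-around of `next` requires.
  vertex-next : ∀ {ℓ} (f : Fin ℓ → Bool) (r : Real (tabulate f) x x vs) (i : Fin ℓ) →
                vertex f r (suc i) ≡ vertex f r (inject₁ (next i))
  vertex-next {ℓ = suc ℓ} f r i with toℕ i ≟ ℓ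
  ... | yes eq = trans (cong (vertex f r) (Fin.toℕ-injective {i = suc i} {fromℕ (suc ℓ)}
                   (cong suc (trans eq (sym (Fin.toℕ-fromℕ ℓ)))))) (vertex-last f r)
  ... | no ne = cong (vertex f r) (sym (Fin.inject₁-lower₁ (suc i) (λ e → ne (suc-injective (sym e)))))

  next-≢ : ∀ {ℓ} → 2 ≤ ℓ → (i : Fin ℓ) → next i ≢ i
  next-≢ {suc ℓ} (s≤s le) i with toℕ i ≟ ℓ
  ... | yes eq = λ where refl → <⇒≢ le eq
  ... | no ne = λ eq → 1+n≢n (trans (sym (Fin.toℕ-lower₁ (suc i) (λ e → ne (suc-injective (sym e))))) (cong toℕ eq))

  unique-ends : x ≢ y → x ∉ is → y ∉ is → Unique is → Unique (x ∷ is ++ [ y ])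
  unique-ends {x} {y} {is} x≢y x∉ y∉ u = unique-↭ (prep x (++-comm [ y ] is))
    ((x≢y ∷ All.tabulate λ where v∈ refl → x∉ v∈) ∷ All.tabulate (λ where v∈ refl → y∉ v∈) ∷ u)

  closed⇒subdivision : ∀ {ℓ} → 2 ≤ ℓ → (o : Fin ℓ → Bool) → Real (tabulate o) x x vs → Unique vs →
                       ContainsSubdivision D (orientedCycle ℓ o)
  closed⇒subdivision {vs = vs} {ℓ = ℓ} 2≤ℓ o r u = record
    { φ = φ
    ; φ-inj = λ {i} {j} → vertex-injective o r u i j
    ; inner = inside o r
    ; isPath = path
    ; avoidsBranch = λ a v v∈ x eq → vertex∉inside o r u x a (subst (_∈ inside o r a) (sym eq) v∈)
    ; internallyDisjoint = λ a b ne v v∈a v∈b → inside-disjoint o r u a b ne (v∈a , v∈b)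
    ; distinctPaths = λ a b ne eq → distinct a b ne eq
    }
    where
    F : Pattern
    F = orientedCycle ℓ o
    φ : Fin ℓ → V
    φ i = vertex o r (inject₁ i)
    φ-next-≢ : ∀ i → φ i ≢ φ (next i)
    φ-next-≢ i eq = next-≢ 2≤ℓ i (sym (vertex-injective o r u i (next i) eq))
    path : ∀ i → IsDiPath D (φ (tail F i) ∷ inside o r i ++ [ φ (head F i) ])
    path i with o i | step-at o r i
    ... | true | s = walk-linked (subst (Walk (φ i) (inside o r i)) (vertex-next o r i) s) ,
      unique-ends (φ-next-≢ i) (vertex∉inside o r u i i) (vertex∉inside o r u (next i) i) (inside-unique o r u i)
    ... | false | s = walk-linked (subst (λ y → Walk y (inside o r i) (φ i)) (vertex-next o r i) s) ,
      unique-ends (φ-next-≢ i ∘ sym) (vertex∉inside o r u (next i) i) (vertex∉inside o r u i i) (inside-unique o r u i)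
    distinct : ∀ a b → a ≢ b → φ (tail F a) ∷ inside o r a ++ [ φ (head F a) ] ≢
                                φ (tail F b) ∷ inside o r b ++ [ φ (head F b) ]
    -- Equal walks would have the same interior, but interiors are nonempty and pairwise disjoint.
    distinct a b ne eq with v , v∈ ← inside-nonempty o r a = inside-disjoint o r u a b ne (v∈ ,
      subst (v ∈_) (proj₁ (∷ʳ-injective (inside o r a) (inside o r b) (∷-injectiveʳ eq))) v∈)

-- Normal form of an orientation up to rotation.

blocks : List (ℕ × ℕ) → List Bool
blocks [] = []
blocks ((p , q) ∷ ps) = replicate (suc p) false ++ replicate (suc q) true ++ blocks ps

private
  -- The word is built up from its right end: a backward letter put before forward letters opens a
  -- new pair, and one put before a pair lengthens it.
  parse : ∀ bs → ∃₂ λ a ps → ∃ λ c → bs ≡ replicate a true ++ blocks ps ++ replicate c false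
  parse [] = 0 , [] , 0 , refl
  parse (true ∷ bs) with a , ps , c , refl ← parse bs = suc a , ps , c , refl
  parse (false ∷ bs) with parse bs
  ... | suc q , ps , c , refl = 0 , (0 , q) ∷ ps , c ,
    cong (λ l → false ∷ true ∷ l) (sym (++-assoc (replicate q true) (blocks ps) (replicate c false)))
  ... | zero , [] , c , refl = 0 , [] , suc c , refl
  ... | zero , (p , q) ∷ ps , c , refl = 0 , (suc p , q) ∷ ps , c , refl

  blocks-snoc : ∀ a pq ps → ∃₂ λ pq′ ps′ → blocks (pq ∷ ps) ++ replicate a true ≡ blocks (pq′ ∷ ps′)
  blocks-snoc a (p , q) [] = (p , q + a) , [] , (begin
    (replicate (suc p) false ++ replicate (suc q) true ++ []) ++ replicate a true
      ≡⟨ ++-assoc (replicate (suc p) false) _ _ ⟩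
    replicate (suc p) false ++ (replicate (suc q) true ++ []) ++ replicate a true
      ≡⟨ cong (λ l → replicate (suc p) false ++ l ++ replicate a true) (++-identityʳ (replicate (suc q) true)) ⟩
    replicate (suc p) false ++ replicate (suc q) true ++ replicate a true
      ≡⟨ cong (replicate (suc p) false ++_) (sym (trans (++-identityʳ _) (replicate-+ (suc q)))) ⟩
    replicate (suc p) false ++ replicate (suc q + a) true ++ [] ∎)
    where
    open ≡-Reasoning
    replicate-+ : ∀ m {x : Bool} → replicate (m + a) x ≡ replicate m x ++ replicate a x
    replicate-+ zero = refl
    replicate-+ (suc m) = cong (_ ∷_) (replicate-+ m)
  blocks-snoc a (p , q) (pq ∷ ps) with pq′ , ps′ , eq ← blocks-snoc a pq ps =
    (p , q) , pq′ ∷ ps′ , trans (++-assoc F _ _) (cong (F ++_) (trans (++-assoc T _ _) (cong (T ++_) eq)))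
    where
    F = replicate (suc p) false
    T = replicate (suc q) true

  blocks-cons : ∀ c p q ps → replicate c false ++ blocks ((p , q) ∷ ps) ≡ blocks ((c + p , q) ∷ ps)
  blocks-cons zero p q ps = refl
  blocks-cons (suc c) p q ps = cong (false ∷_) (blocks-cons c p q ps)

-- A pair in `blocks` leads backward from a sink to a source and then forward to the next sink. A
-- nonconstant orientation has this form once it is read from a suitable sink.
data Shape (bs : List Bool) : Set where
  constant : ∀ b → bs ≡ replicate (length bs) b → Shape bs
  alternating : ∀ xs ys pq ps → bs ≡ xs ++ ys → ys ++ xs ≡ blocks (pq ∷ ps) → Shape bs

-- Rotation moves leading forward letters behind the last pair and trailing backward letters before
-- the first; if both occur, they join to a pair of their own.
shape : ∀ bs → Shape bs
shape bs with parse bs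
... | suc a , ps , suc c , refl =
  alternating (replicate (suc a) true ++ blocks ps) (replicate (suc c) false) (c , a) ps
    (sym (++-assoc (replicate (suc a) true) (blocks ps) _)) refl
... | zero , [] , c , refl = constant false (cong (λ k → replicate k false) (sym (length-replicate c)))
... | zero , (p , q) ∷ ps , suc c , refl =
  alternating (blocks ((p , q) ∷ ps)) (replicate (suc c) false) (suc c + p , q) ps refl (blocks-cons (suc c) p q ps)
... | a , [] , zero , refl = constant true (trans (++-identityʳ (replicate a true))
  (cong (λ k → replicate k true) (sym (trans (cong length (++-identityʳ (replicate a true))) (length-replicate a)))))
... | a , pq ∷ ps , zero , refl with pq′ , ps′ , eq ← blocks-snoc a pq ps =
  alternating (replicate a true) (blocks (pq ∷ ps)) pq′ ps′
    (cong (replicate a true ++_) (++-identityʳ (blocks (pq ∷ ps)))) eq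

record Short (ℓ : ℕ) (pq : ℕ × ℕ) : Set where
  field
    fst< : proj₁ pq < ℓ
    snd< : proj₂ pq < ℓ

length-blocks-∷ : ∀ p q ps → length (blocks ((p , q) ∷ ps)) ≡ suc p + (suc q + length (blocks ps))
length-blocks-∷ p q ps = trans (length-++ (replicate (suc p) false)) (cong₂ _+_ (length-replicate (suc p))
  (trans (length-++ (replicate (suc q) true)) (cong (_+ length (blocks ps)) (length-replicate (suc q)))))

blocks-short : ∀ {ℓ} ps → length (blocks ps) ≤ ℓ → All (Short ℓ) ps
blocks-short [] le = []
blocks-short {ℓ} ((p , q) ∷ ps) le =
  record { fst< = ≤-trans (m≤m+n (suc p) _) le′
         ; snd< = ≤-trans (≤-trans (m≤m+n (suc q) _) (m≤n+m _ (suc p))) le′ }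
  ∷ blocks-short ps (≤-trans (≤-trans (m≤n+m _ (suc q)) (m≤n+m _ (suc p))) le′)
  where
  le′ : suc p + (suc q + length (blocks ps)) ≤ ℓ
  le′ = subst (_≤ ℓ) (length-blocks-∷ p q ps) le

length≤blocks : ∀ ps → length ps ≤ length (blocks ps)
length≤blocks [] = z≤n
length≤blocks ((p , q) ∷ ps) = subst (suc (length ps) ≤_) (sym (length-blocks-∷ p q ps))
  (s≤s (≤-trans (length≤blocks ps) (≤-trans (m≤n+m _ (suc q)) (m≤n+m _ p))))

-- Greedy growth of legs, and long directed cycles.

module Growing (D : Digraph) (A : List (Fin (n D))) where
  open Walks D

  private variable
    x y : V
    l Z : List V

  outA : V → List V
  outA x = filter (x ⇒?_) A

  Dead : V → List V → Set
  Dead y Z = ∀ {t} → y ⇒ t → t ∈ A → t ∈ Z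

  record Fresh (Z l : List V) : Set where
    constructor fresh
    field
      unique : Unique l
      ⊆A     : l ⊆ A
      apart  : Disjoint l Z

  Fresh-++ : ∀ {l l′} → Fresh Z l → Fresh (l ++ Z) l′ → Fresh Z (l ++ l′)
  Fresh-++ {l = l} (fresh u s d) (fresh u′ s′ d′) =
    fresh (Unique.++⁺ u u′ λ (v∈ , v∈′) → d′ (v∈′ , ∈-++⁺ˡ v∈))
      ([ s , s′ ]′ ∘ ∈-++⁻ l)
      λ (v∈ , v∈Z) → [ (λ v∈l → d (v∈l , v∈Z)) , (λ v∈l′ → d′ (v∈l′ , ∈-++⁺ʳ l v∈Z)) ]′ (∈-++⁻ l v∈)

  record Grown (j : ℕ) (x : V) (Z : List V) : Set where
    constructor grown
    field
      {list}  : List V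
      {tip}   : V
      leg     : Leg x list tip
      len     : length list ≡ j
      isFresh : Fresh Z list

  record Stuck (j : ℕ) (x : V) (Z : List V) : Set where
    constructor stuck
    field
      {list}  : List V
      {tip}   : V
      leg     : Leg x list tip
      len     : length list < j
      isFresh : Fresh Z list
      isDead  : Dead tip (list ++ Z)

  -- Any out-neighbour in `A` outside the used vertices `Z` extends the leg; if there is none, the
  -- current tip is dead.
  grow-leg : ∀ j x Z → Grown j x Z ⊎ Stuck j x Z
  grow-leg zero x Z = inj₁ (grown [] refl (fresh [] (λ ()) (λ ())))
  grow-leg (suc j) x Z with Any.any? (λ t → (x ⇒? t) ×-dec ¬? (t ∈? Z)) A
  ... | no none = inj₂ (stuck [] (s≤s z≤n) (fresh [] (λ ()) (λ ())) dead)
    where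
    dead : Dead x Z
    dead {t} x⇒t t∈A with t ∈? Z
    ... | yes t∈Z = t∈Z
    ... | no t∉Z = ⊥-elim (none (Any.map (λ where refl → x⇒t , t∉Z) t∈A))
  ... | yes some with t , t∈A , x⇒t , t∉Z ← find some = extend (grow-leg j t (t ∷ Z))
    where
    singleton : Fresh Z [ t ]
    singleton = fresh ([] ∷ []) (λ where (here refl) → t∈A) (λ where (here refl , t∈Z) → t∉Z t∈Z)
    extend : Grown j t (t ∷ Z) ⊎ Stuck j t (t ∷ Z) → Grown (suc j) x Z ⊎ Stuck (suc j) x Z
    extend (inj₁ (grown leg len fr)) = inj₁ (grown (x⇒t ∷ leg) (cong suc len) (Fresh-++ singleton fr))
    extend (inj₂ (stuck {l} leg len fr dead)) =
      inj₂ (stuck (x⇒t ∷ leg) (s≤s len) (Fresh-++ singleton fr)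
        (λ a b → ∈-resp-↭ (shift t l Z) (dead a b)))

  module _ (A-unique : Unique A) {k : ℕ} (0<k : 0 < k) (outdeg≥ : ∀ {v} → v ∈ A → k ≤ length (outA v)) where

    private
      -- The closed walk starts at the first out-neighbour of the tip on the leg, so that all k of
      -- them lie on it.
      close : ∀ {x l y} → Leg x l y → Unique (x ∷ l) → k ≤ length (outA y) → outA y ⊆ x ∷ l →
              ∃₂ λ c is → Walk c is c × Unique (c ∷ is) × k ≤ suc (length is)
      close {x} {l} {y} leg u le sub with y ⇒? x
      ... | yes y⇒x = x , l , leg ▹ y⇒x , u ,
        ≤-trans le (unique-⊆⇒length≤ (Unique.filter⁺ (y ⇒?_) A-unique) sub)
      ... | no y⇏x = next-start leg u
        where
        sub′ : outA y ⊆ l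
        sub′ v∈ with sub v∈
        ... | here refl = ⊥-elim (y⇏x (proj₂ (∈-filter⁻ (y ⇒?_) {xs = A} v∈)))
        ... | there v∈l = v∈l
        next-start : Leg x l y → Unique (x ∷ l) → _
        next-start [] _ = contradiction
          (≤-trans le (unique-⊆⇒length≤ (Unique.filter⁺ (y ⇒?_) A-unique) sub′)) (<⇒≱ 0<k)
        next-start (_ ∷ leg′) (_ ∷ u′) = close leg′ u′ le sub′

    -- A leg with more than `length A` vertices does not fit into `A`, so growth stops at a tip
    -- whose out-neighbours in `A` all lie on the path already built.
    long-cycle : ∀ {x} → x ∈ A → ∃₂ λ c is → Walk c is c × Unique (c ∷ is) × k ≤ suc (length is)
    long-cycle {x} x∈A with grow-leg (suc (length A)) x [ x ]
    ... | inj₁ (grown _ len (fresh u s _)) =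
      contradiction (subst (_≤ length A) len (unique-⊆⇒length≤ u s)) 1+n≰n
    ... | inj₂ (stuck {l} {y} leg _ (fresh u s d) dead) = close leg
      ((All.tabulate λ where v∈ refl → d (v∈ , here refl)) ∷ u) (outdeg≥ y∈A) sub
      where
      y∈A : y ∈ A
      y∈A with end∈leg leg
      ... | here refl = x∈A
      ... | there y∈l = s y∈l
      sub : outA y ⊆ x ∷ l
      sub v∈ with v∈A , y⇒v ← ∈-filter⁻ (y ⇒?_) {xs = A} v∈ = ∈-resp-↭ (++-comm l [ x ]) (dead y⇒v v∈A)

-- Vertices reached from `e` without entering a forbidden set.

module Reaching (D : Digraph) (Forb : List (Fin (n D))) (e : Fin (n D)) where
  open Walks D

  -- Only the vertices after `e` must avoid `Forb`: the searches below start at a vertex of the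
  -- forbidden set itself.
  Reached : List V → V → Set
  Reached R v = ∃ λ l → Leg e l v × Unique (e ∷ l) × (∀ {u} → u ∈ l → u ∈ R × u ∉ Forb)

  record Reach : Set where
    field
      R       : List V
      e∈R     : e ∈ R
      reached : ∀ {v} → v ∈ R → Reached R v
      closed  : ∀ {u v} → u ∈ R → u ⇒ v → v ∈ R ⊎ v ∈ Forb

  private
    -- Each round adds a vertex, so `R` would exceed the vertex set once the fuel is spent.
    loop : ∀ fuel R → n D < fuel + length R → Unique R → e ∈ R → (∀ {v} → v ∈ R → Reached R v) → Reach
    loop zero R lt u _ _ = contradiction (unique-⊆⇒length≤ u (λ {v} _ → ∈-allFin v))
      (<⇒≱ (subst (_< length R) (sym (length-tabulate {n = n D} id)) lt))
    loop (suc fuel) R lt uR e∈R reached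
      with Any.any? (λ u → Fin.any? (λ v → (u ⇒? v) ×-dec ¬? (v ∈? R) ×-dec ¬? (v ∈? Forb))) R
    ... | no none = record { R = R ; e∈R = e∈R ; reached = reached ; closed = closed }
      where
      closed : ∀ {u v} → u ∈ R → u ⇒ v → v ∈ R ⊎ v ∈ Forb
      closed {u} {v} u∈R u⇒v with v ∈? R | v ∈? Forb
      ... | yes v∈R | _ = inj₁ v∈R
      ... | no _ | yes v∈F = inj₂ v∈F
      ... | no v∉R | no v∉F = ⊥-elim (none (Any.map (λ where refl → v , u⇒v , v∉R , v∉F) u∈R))
    ... | yes some with u , u∈R , v , u⇒v , v∉R , v∉F ← find some =
      loop fuel (v ∷ R) (subst (n D <_) (sym (+-suc fuel (length R))) lt)
        ((All.tabulate λ where w∈ refl → v∉R w∈) ∷ uR) (there e∈R) reached′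
      where
      reached′ : ∀ {w} → w ∈ v ∷ R → Reached (v ∷ R) w
      reached′ (there w∈R) with l , leg , ul , l⊆ ← reached w∈R =
        l , leg , ul , λ x∈ → there (proj₁ (l⊆ x∈)) , proj₂ (l⊆ x∈)
      reached′ (here refl) with l , leg , ul , l⊆ ← reached u∈R =
        l ++ [ v ] , leg ++ᴸ (u⇒v ∷ []) ,
        unique-↭ (++-comm [ v ] (e ∷ l)) ((All.tabulate λ where
          (here refl) refl → v∉R e∈R
          (there w∈) refl → v∉R (proj₁ (l⊆ w∈))) ∷ ul) ,
        λ x∈ → [ (λ x∈l → there (proj₁ (l⊆ x∈l)) , proj₂ (l⊆ x∈l)) ,
                 (λ where (here refl) → here refl , v∉F) ]′ (∈-++⁻ l x∈)

  abstract
    reach : Reach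
    reach = loop (suc (n D)) [ e ] (s≤s (m≤m+n (n D) 1)) ([] ∷ []) (here refl)
      λ where (here refl) → [] , [] , ([] ∷ []) , λ ()

-- Maximum families of spiders and their dead extensions.

module Spiders (D : Digraph) (A : List (Fin (n D))) (m : ℕ) where
  open Walks D
  open Growing D A

  private variable
    e : V
    j : ℕ
    Z : List V

  -- Disjointness of the legs is not recorded here; it follows whenever the concatenated list is
  -- duplicate-free.
  data Legs (e : V) : ℕ → List V → Set where
    []   : Legs e 0 []
    cons : ∀ {j l y g} → Leg e l y → length l ≡ m → Legs e j g → Legs e (suc j) (l ++ g)

  length-legs : ∀ {g} → Legs e j g → length g ≡ j * m
  length-legs [] = refl
  length-legs (cons {l = l} _ len legs) = trans (length-++ l) (cong₂ _+_ len (length-legs legs))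

  record Blocked (e : V) (g Z : List V) : Set where
    constructor blocked
    field
      {list} : List V
      {tip}  : V
      leg    : Leg e list tip
      unique : Unique list
      len    : length list ≤ m
      ⊆g     : list ⊆ g
      isDead : Dead tip Z

  -- The legs are tried one after another until one gets stuck. Then `g` also keeps the legs
  -- completed before, because the dead tip may have out-neighbours on them.
  grow-legs : ∀ j e Z → ∃ λ g → Fresh Z g × length g ≤ j * m × (Legs e j g ⊎ Blocked e g (g ++ Z))
  grow-legs zero e Z = [] , fresh [] (λ ()) (λ ()) , z≤n , inj₁ []
  grow-legs (suc j) e Z with grow-leg m e Z
  ... | inj₂ (stuck {l} leg len fr dead) =
    l , fr , ≤-trans (<⇒≤ len) (m≤m+n m _) ,
    inj₂ (blocked leg (Fresh.unique fr) (<⇒≤ len) id dead)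
  ... | inj₁ (grown {l} leg len fr) with grow-legs j e (l ++ Z)
  ... | g , fr′ , le , status =
    l ++ g , Fresh-++ fr fr′ ,
    ≤-trans (≤-reflexive (length-++ l)) (+-mono-≤ (≤-reflexive len) le) ,
    Sum.map (cons leg len)
      (λ (blocked leg u len ⊆g dead) → blocked leg u len (∈-++⁺ʳ l ∘ ⊆g)
        (λ a b → ∈-resp-↭ perm (dead a b))) status
    where
    perm : g ++ l ++ Z ↭ (l ++ g) ++ Z
    perm = ↭-trans (shifts g l) (↭-reflexive (sym (++-assoc l g Z)))

  record Spider : Set where
    constructor spider
    field
      {center} : V
      {body}   : List V
      legs     : Legs center 3 body
      unique   : Unique (center ∷ body)
      ⊆A       : center ∷ body ⊆ A
    verts : List V
    verts = center ∷ body
  open Spider using (verts)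

  -- A source with two disjoint long legs, extended until they get stuck. Its territory O also
  -- contains every vertex consumed while extending the legs.
  record Bundle : Set where
    field
      center  : V
      leg     : Bool → List V
      tip     : Bool → V
      isLeg   : ∀ a → Leg center (leg a) (tip a)
      long    : ∀ a → m ≤ length (leg a)
      short   : ∀ a → length (leg a) ≤ m + m
      unique  : ∀ a → Unique (center ∷ leg a ++ leg (not a))
      O       : List V
      O-small : length O ≤ suc (12 * m)
      center∈O : center ∈ O
      leg⊆O   : ∀ a → leg a ⊆ O
      O⊆A     : O ⊆ A
  open Bundle using (O)

  IsDead : List V → Bundle → Set
  IsDead Z b = ∀ a → Dead (Bundle.tip b a) Z

  IsDead-mono : ∀ {Y Z} b → Y ⊆ Z → IsDead Y b → IsDead Z b
  IsDead-mono b Y⊆Z dead a x⇒t t∈A = Y⊆Z (dead a x⇒t t∈A)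

  module _ (0<m : 0 < m) where

    module Extend (sp : Spider) (Z : List V) (sp⊆Z : verts sp ⊆ Z) where
      open Spider sp using (center; body)

      Fresh? : List V → Set
      Fresh? l = ∀ {v} → v ∈ l → v ∈ verts sp ⊎ v ∉ Z

      -- One leg `l` of the old spider, and the attempt `g`, successful or blocked, to grow a new
      -- spider at its end `y`.
      record End (G Z′ : List V) : Set where
        field
          {l g}  : List V
          {y}    : V
          leg    : Leg center l y
          len    : length l ≡ m
          l-uniq : Unique l
          l⊆     : l ⊆ body
          fr     : Fresh Z g
          g⊆G    : g ⊆ G
          status : Legs y 3 g ⊎ Blocked y g Z′
        y∈l : y ∈ l
        y∈l = tip∈leg leg (subst (0 <_) (sym len) 0<m)

        new-spider : Legs y 3 g → ∃ λ s → verts s ≡ y ∷ g × Fresh? (verts s)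
        new-spider legs = spider legs
          ((All.tabulate λ where v∈ refl → Fresh.apart fr (v∈ , y∈Z)) ∷ Fresh.unique fr)
          (λ where (here refl) → Spider.⊆A sp y∈sp
                   (there v∈) → Fresh.⊆A fr v∈) ,
          refl ,
          λ where (here refl) → inj₁ y∈sp
                  (there v∈) → inj₂ (λ v∈Z → Fresh.apart fr (v∈ , v∈Z))
          where
          y∈sp : y ∈ verts sp
          y∈sp = there (l⊆ y∈l)
          y∈Z : y ∈ Z
          y∈Z = sp⊆Z y∈sp
      open End using (l; g; y)

      Apart : ∀ {G Z′} → End G Z′ → End G Z′ → Set
      Apart E E′ = Disjoint (l E) (l E′) × Disjoint (g E) (g E′)

      Better : Set
      Better = ∃₂ λ s s′ → Disjoint (verts s) (verts s′) × Fresh? (verts s) × Fresh? (verts s′)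

      module _ {G Z′} (E E′ : End G Z′) (apart : Apart E E′) where
        private
          module E = End E
          module E′ = End E′

        both-full : Legs E.y 3 E.g → Legs E′.y 3 E′.g → Better
        both-full legs legs′ with s , refl , f ← E.new-spider legs | s′ , refl , f′ ← E′.new-spider legs′ =
          s , s′ , disj , f , f′
          where
          disj : Disjoint (E.y ∷ E.g) (E′.y ∷ E′.g)
          disj (here refl , here eq) = proj₁ apart (E.y∈l , subst (_∈ E′.l) (sym eq) E′.y∈l)
          disj (here refl , there v∈) = Fresh.apart E′.fr (v∈ , sp⊆Z (there (E.l⊆ E.y∈l)))
          disj (there v∈ , here refl) = Fresh.apart E.fr (v∈ , sp⊆Z (there (E′.l⊆ E′.y∈l)))
          disj (there v∈ , there v∈′) = proj₂ apart (v∈ , v∈′)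

        -- Each leg of the bundle is an old leg of exactly `m` vertices followed by a blocked
        -- extension of at most `m`, which gives both length bounds.
        both-dead : G ⊆ A → length (verts sp ++ G) ≤ suc (12 * m) →
                    Blocked E.y E.g Z′ → Blocked E′.y E′.g Z′ →
                    ∃ λ b → O b ≡ verts sp ++ G × IsDead Z′ b
        both-dead G⊆A small B B′ = record
          { center = center
          ; leg = leg
          ; tip = λ where true → B.tip ; false → B′.tip
          ; isLeg = λ where true → E.leg ++ᴸ B.leg ; false → E′.leg ++ᴸ B′.leg
          ; long = λ where true → long E.l B.list E.len ; false → long E′.l B′.list E′.len
          ; short = λ where true → short E.l B.list E.len B.len ; false → short E′.l B′.list E′.len B′.len
          ; unique = uniq
          ; O = verts sp ++ G
          ; O-small = small
          ; center∈O = here refl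
          ; leg⊆O = λ a → [ ∈-++⁺ˡ ∘ there , ∈-++⁺ʳ (verts sp) ∘ proj₁ ]′ ∘ leg-in a
          ; O⊆A = [ Spider.⊆A sp , G⊆A ]′ ∘ ∈-++⁻ (verts sp)
          } , refl , λ where true → B.isDead ; false → B′.isDead
          where
          module B = Blocked B
          module B′ = Blocked B′
          leg : Bool → List V
          leg true = E.l ++ B.list
          leg false = E′.l ++ B′.list
          long : ∀ l l′ → length l ≡ m → m ≤ length (l ++ l′)
          long l l′ refl = ≤-trans (m≤m+n _ _) (≤-reflexive (sym (length-++ l)))
          short : ∀ l l′ → length l ≡ m → length l′ ≤ m → length (l ++ l′) ≤ m + m
          short l l′ refl le = ≤-trans (≤-reflexive (length-++ l)) (+-monoʳ-≤ _ le)
          leg-in : ∀ a {v} → v ∈ leg a → v ∈ body ⊎ (v ∈ G × v ∉ Z)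
          leg-in true v∈ = Sum.map E.l⊆ (λ v∈ → E.g⊆G (B.⊆g v∈) , λ v∈Z → Fresh.apart E.fr (B.⊆g v∈ , v∈Z)) (∈-++⁻ E.l v∈)
          leg-in false v∈ = Sum.map E′.l⊆ (λ v∈ → E′.g⊆G (B′.⊆g v∈) , λ v∈Z → Fresh.apart E′.fr (B′.⊆g v∈ , v∈Z)) (∈-++⁻ E′.l v∈)
          center∉leg : ∀ a → center ∉ leg a
          center∉leg a v∈ with leg-in a v∈
          ... | inj₁ v∈b = Unique.Unique[x∷xs]⇒x∉xs (Spider.unique sp) v∈b
          ... | inj₂ (_ , v∉Z) = v∉Z (sp⊆Z (here refl))
          l∩g=∅ : ∀ {l g g′ : List V} → l ⊆ body → Fresh Z g → g′ ⊆ g → Disjoint l g′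
          l∩g=∅ l⊆ fr g′⊆ (v∈ , v∈′) = Fresh.apart fr (g′⊆ v∈′ , sp⊆Z (there (l⊆ v∈)))
          leg-unique : ∀ a → Unique (leg a)
          leg-unique true = Unique.++⁺ E.l-uniq B.unique (l∩g=∅ E.l⊆ E.fr B.⊆g)
          leg-unique false = Unique.++⁺ E′.l-uniq B′.unique (l∩g=∅ E′.l⊆ E′.fr B′.⊆g)
          legs-apart : Disjoint (leg true) (leg false)
          legs-apart (v∈ , v∈′) with ∈-++⁻ E.l v∈ | ∈-++⁻ E′.l v∈′
          ... | inj₁ a | inj₁ b = proj₁ apart (a , b)
          ... | inj₁ a | inj₂ b = l∩g=∅ E.l⊆ E′.fr B′.⊆g (a , b)
          ... | inj₂ a | inj₁ b = l∩g=∅ E′.l⊆ E.fr B.⊆g (b , a)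
          ... | inj₂ a | inj₂ b = proj₂ apart (B.⊆g a , B′.⊆g b)
          uniq : ∀ a → Unique (center ∷ leg a ++ leg (not a))
          uniq a = (All.tabulate λ where v∈ refl → [ center∉leg a , center∉leg (not a) ]′ (∈-++⁻ (leg a) v∈)) ∷
            Unique.++⁺ (leg-unique a) (leg-unique (not a)) (apart′ a)
            where
            apart′ : ∀ a → Disjoint (leg a) (leg (not a))
            apart′ true = legs-apart
            apart′ false (v∈ , v∈′) = legs-apart (v∈′ , v∈)

      record Exhausted : Set where
        field
          bundle : Bundle
          Z′     : List V
          isDead : IsDead Z′ bundle
          Z⊆Z′   : Z ⊆ Z′
          O⊆Z′   : O bundle ⊆ Z′
          Z′⊆    : ∀ {v} → v ∈ Z′ → v ∈ Z ⊎ v ∈ O bundle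
          O-new  : Fresh? (O bundle)
          sp⊆O   : verts sp ⊆ O bundle

      -- If new spiders grow out of two of the three leg ends, these two replace the old spider;
      -- otherwise two legs have dead extensions.
      exhaust : Better ⊎ Exhausted
      exhaust with Spider.legs sp | Spider.unique sp | length-legs (Spider.legs sp)
      ... | cons {l = l₁} {y₁} leg₁ len₁ (cons {l = l₂} {y₂} leg₂ len₂ (cons {l = l₃} {y₃} leg₃ len₃ [])) | _ ∷ uniq | len-body
        with grow-legs 3 y₁ Z
      ... | g₁ , fr₁ , le₁ , st₁ with grow-legs 3 y₂ (g₁ ++ Z)
      ... | g₂ , fr₂ , le₂ , st₂ with grow-legs 3 y₃ (g₂ ++ g₁ ++ Z)
      ... | g₃ , fr₃ , le₃ , st₃
        with u₁ , u₂₃ , d₁ ← unique-++⁻ l₁ uniq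
        with u₂ , u₃ , d₂ ← unique-++⁻ l₂ u₂₃
        with u₃ , _ , _ ← unique-++⁻ l₃ u₃ = decide (End.status E₁) (End.status E₂) (End.status E₃)
        where
        G Z₃ : List V
        G = g₁ ++ g₂ ++ g₃
        Z₃ = g₃ ++ g₂ ++ g₁ ++ Z
        weaken : ∀ {y g Y} → Y ⊆ Z₃ → Legs y 3 g ⊎ Blocked y g Y → Legs y 3 g ⊎ Blocked y g Z₃
        weaken Y⊆ = Sum.map id λ (blocked leg u len ⊆g dead) → blocked leg u len ⊆g (λ a b → Y⊆ (dead a b))
        loosen : ∀ {X Y g} → Y ⊆ X → Fresh X g → Fresh Y g
        loosen Y⊆ (fresh u s d) = fresh u s λ (a , b) → d (a , Y⊆ b)
        E₁ E₂ E₃ : End G Z₃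
        E₁ = record { leg = leg₁ ; len = len₁ ; l-uniq = u₁ ; l⊆ = ∈-++⁺ˡ ; fr = fr₁ ; g⊆G = ∈-++⁺ˡ
                    ; status = weaken (∈-++⁺ʳ g₃ ∘ ∈-++⁺ʳ g₂) st₁ }
        E₂ = record { leg = leg₂ ; len = len₂ ; l-uniq = u₂ ; l⊆ = ∈-++⁺ʳ l₁ ∘ ∈-++⁺ˡ
                    ; fr = loosen (∈-++⁺ʳ g₁) fr₂ ; g⊆G = ∈-++⁺ʳ g₁ ∘ ∈-++⁺ˡ
                    ; status = weaken (∈-++⁺ʳ g₃) st₂ }
        E₃ = record { leg = leg₃ ; len = len₃ ; l-uniq = u₃ ; l⊆ = ∈-++⁺ʳ l₁ ∘ ∈-++⁺ʳ l₂ ∘ ∈-++⁺ˡ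
                    ; fr = loosen (∈-++⁺ʳ g₂ ∘ ∈-++⁺ʳ g₁) fr₃ ; g⊆G = ∈-++⁺ʳ g₁ ∘ ∈-++⁺ʳ g₂
                    ; status = weaken id st₃ }
        a₁₂ : Apart E₁ E₂
        a₁₂ = (λ (a , b) → d₁ (a , ∈-++⁺ˡ b)) , λ (a , b) → Fresh.apart fr₂ (b , ∈-++⁺ˡ a)
        a₁₃ : Apart E₁ E₃
        a₁₃ = (λ (a , b) → d₁ (a , ∈-++⁺ʳ l₂ (∈-++⁺ˡ b))) ,
              λ (a , b) → Fresh.apart fr₃ (b , ∈-++⁺ʳ g₂ (∈-++⁺ˡ a))
        a₂₃ : Apart E₂ E₃
        a₂₃ = (λ (a , b) → d₂ (a , ∈-++⁺ˡ b)) , λ (a , b) → Fresh.apart fr₃ (b , ∈-++⁺ˡ a)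
        G-fresh : ∀ {v} → v ∈ G → v ∈ A × v ∉ Z
        G-fresh v∈ with ∈-++⁻ g₁ v∈
        ... | inj₁ v∈₁ = Fresh.⊆A fr₁ v∈₁ , λ v∈Z → Fresh.apart fr₁ (v∈₁ , v∈Z)
        ... | inj₂ v∈₂₃ with ∈-++⁻ g₂ v∈₂₃
        ... | inj₁ v∈₂ = Fresh.⊆A fr₂ v∈₂ , λ v∈Z → Fresh.apart (End.fr E₂) (v∈₂ , v∈Z)
        ... | inj₂ v∈₃ = Fresh.⊆A fr₃ v∈₃ , λ v∈Z → Fresh.apart (End.fr E₃) (v∈₃ , v∈Z)
        -- The center, three old legs, and three attempts of at most three legs each.
        small : length (verts sp ++ G) ≤ suc (12 * m)
        small = s≤s (begin
          length (body ++ G) ≡⟨ length-++ body ⟩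
          length body + length G ≡⟨ cong₂ _+_ len-body (trans (length-++ g₁) (cong (length g₁ +_) (length-++ g₂))) ⟩
          3 * m + (length g₁ + (length g₂ + length g₃))
            ≤⟨ +-monoʳ-≤ (3 * m) (+-mono-≤ le₁ (+-mono-≤ le₂ le₃)) ⟩
          3 * m + (3 * m + (3 * m + 3 * m)) ≡⟨ lemma m ⟩
          12 * m ∎)
          where
          open ≤-Reasoning
          lemma : ∀ m → 3 * m + (3 * m + (3 * m + 3 * m)) ≡ 12 * m
          lemma = solve-∀
        G⊆Z₃ : G ⊆ Z₃
        G⊆Z₃ v∈ with ∈-++⁻ g₁ v∈
        ... | inj₁ v∈₁ = ∈-++⁺ʳ g₃ (∈-++⁺ʳ g₂ (∈-++⁺ˡ v∈₁))
        ... | inj₂ v∈₂₃ with ∈-++⁻ g₂ v∈₂₃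
        ... | inj₁ v∈₂ = ∈-++⁺ʳ g₃ (∈-++⁺ˡ v∈₂)
        ... | inj₂ v∈₃ = ∈-++⁺ˡ v∈₃
        Z₃⊆ : ∀ {v} → v ∈ Z₃ → v ∈ Z ⊎ v ∈ verts sp ++ G
        Z₃⊆ v∈ with ∈-++⁻ g₃ v∈
        ... | inj₁ v∈₃ = inj₂ (∈-++⁺ʳ (verts sp) (∈-++⁺ʳ g₁ (∈-++⁺ʳ g₂ v∈₃)))
        ... | inj₂ v∈₂₁ with ∈-++⁻ g₂ v∈₂₁
        ... | inj₁ v∈₂ = inj₂ (∈-++⁺ʳ (verts sp) (∈-++⁺ʳ g₁ (∈-++⁺ˡ v∈₂)))
        ... | inj₂ v∈₁ with ∈-++⁻ g₁ v∈₁
        ... | inj₁ v∈₁ = inj₂ (∈-++⁺ʳ (verts sp) (∈-++⁺ˡ v∈₁))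
        ... | inj₂ v∈Z = inj₁ v∈Z
        finish : (∃ λ b → O b ≡ verts sp ++ G × IsDead Z₃ b) → Better ⊎ Exhausted
        finish (b , eq , dead) = inj₂ (record
          { bundle = b ; Z′ = Z₃ ; isDead = dead ; Z⊆Z′ = Z⊆Z₃
          ; O⊆Z′ = λ v∈ → [ Z⊆Z₃ ∘ sp⊆Z , G⊆Z₃ ]′ (∈-++⁻ (verts sp) (subst (_ ∈_) eq v∈))
          ; Z′⊆ = λ v∈ → subst (λ l → _ ∈ Z ⊎ _ ∈ l) (sym eq) (Z₃⊆ v∈)
          ; O-new = λ v∈ → Sum.map id (proj₂ ∘ G-fresh) (∈-++⁻ (verts sp) (subst (_ ∈_) eq v∈))
          ; sp⊆O = λ v∈ → subst (_ ∈_) (sym eq) (∈-++⁺ˡ v∈)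
          })
          where
          Z⊆Z₃ : Z ⊆ Z₃
          Z⊆Z₃ = ∈-++⁺ʳ g₃ ∘ ∈-++⁺ʳ g₂ ∘ ∈-++⁺ʳ g₁
        decide : Legs y₁ 3 g₁ ⊎ Blocked y₁ g₁ Z₃ → Legs y₂ 3 g₂ ⊎ Blocked y₂ g₂ Z₃ →
                 Legs y₃ 3 g₃ ⊎ Blocked y₃ g₃ Z₃ → Better ⊎ Exhausted
        decide (inj₁ f₁) (inj₁ f₂) _ = inj₁ (both-full E₁ E₂ a₁₂ f₁ f₂)
        decide (inj₁ f₁) (inj₂ b₂) (inj₁ f₃) = inj₁ (both-full E₁ E₃ a₁₃ f₁ f₃)
        decide (inj₁ f₁) (inj₂ b₂) (inj₂ b₃) = finish (both-dead E₂ E₃ a₂₃ (proj₁ ∘ G-fresh) small b₂ b₃)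
        decide (inj₂ b₁) (inj₁ f₂) (inj₁ f₃) = inj₁ (both-full E₂ E₃ a₂₃ f₂ f₃)
        decide (inj₂ b₁) (inj₁ f₂) (inj₂ b₃) = finish (both-dead E₁ E₃ a₁₃ (proj₁ ∘ G-fresh) small b₁ b₃)
        decide (inj₂ b₁) (inj₂ b₂) _ = finish (both-dead E₁ E₂ a₁₂ (proj₁ ∘ G-fresh) small b₁ b₂)

    allVerts : List Spider → List V
    allVerts = concatMap verts

    -- The last clause allows an enlarged tail to be put back behind the earlier spiders, whose
    -- vertices all lie in `Z`.
    Larger : List Spider → List V → Set
    Larger ss Z = ∃ λ ss′ → length ss′ ≡ suc (length ss) × Unique (allVerts ss′) ×
      (∀ {v} → v ∈ allVerts ss′ → v ∈ allVerts ss ⊎ v ∉ Z)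

    record DeadFamily (ss : List Spider) (Z : List V) : Set where
      field
        bundles  : List Bundle
        size     : length bundles ≡ length ss
        Z′       : List V
        Z⊆Z′     : Z ⊆ Z′
        isDead   : All (IsDead Z′) bundles
        disjoint : AllPairs (λ b b′ → Disjoint (O b) (O b′)) bundles
        Z′⊆      : ∀ {v} → v ∈ Z′ → v ∈ Z ⊎ v ∈ concatMap O bundles
        O-new    : ∀ {v} → v ∈ concatMap O bundles → v ∈ allVerts ss ⊎ v ∉ Z
        ss⊆O     : allVerts ss ⊆ concatMap O bundles

    -- `Z` contains the spiders still to be treated and grows by everything consumed, which keeps
    -- the territories disjoint. A spider that can be replaced by two yields a larger family.
    exhaust-all : ∀ ss Z → Unique (allVerts ss) → allVerts ss ⊆ Z → Larger ss Z ⊎ DeadFamily ss Z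
    exhaust-all [] Z u sub = inj₂ (record
      { bundles = [] ; size = refl ; Z′ = Z ; Z⊆Z′ = id ; isDead = [] ; disjoint = []
      ; Z′⊆ = inj₁ ; O-new = λ () ; ss⊆O = λ () })
    exhaust-all (s ∷ ss) Z u sub
      with u-s , u-ss , s∩ss=∅ ← unique-++⁻ (verts s) u
      with Extend.exhaust s Z (λ v∈ → sub (∈-++⁺ˡ v∈))
    ... | inj₁ (s₁ , s₂ , d , f₁ , f₂) = inj₁ (s₁ ∷ s₂ ∷ ss , refl ,
      Unique.++⁺ (Spider.unique s₁) (Unique.++⁺ (Spider.unique s₂) u-ss (λ (a , b) → avoid (f₂ a) b))
        (λ (a , b) → [ (λ b → d (a , b)) , avoid (f₁ a) ]′ (∈-++⁻ (verts s₂) b)) , origin)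
      where
      avoid : ∀ {v} → v ∈ verts s ⊎ v ∉ Z → v ∉ allVerts ss
      avoid (inj₁ v∈s) v∈ss = s∩ss=∅ (v∈s , v∈ss)
      avoid (inj₂ v∉Z) v∈ss = v∉Z (sub (∈-++⁺ʳ (verts s) v∈ss))
      origin : ∀ {v} → v ∈ verts s₁ ++ verts s₂ ++ allVerts ss → v ∈ verts s ++ allVerts ss ⊎ v ∉ Z
      origin v∈ with ∈-++⁻ (verts s₁) v∈
      ... | inj₁ v∈₁ = Sum.map ∈-++⁺ˡ id (f₁ v∈₁)
      ... | inj₂ v∈′ with ∈-++⁻ (verts s₂) v∈′
      ... | inj₁ v∈₂ = Sum.map ∈-++⁺ˡ id (f₂ v∈₂)
      ... | inj₂ v∈ss = inj₁ (∈-++⁺ʳ (verts s) v∈ss)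
    ... | inj₂ ex with exhaust-all ss (Extend.Exhausted.Z′ ex) u-ss
                         (λ v∈ → Extend.Exhausted.Z⊆Z′ ex (sub (∈-++⁺ʳ (verts s) v∈)))
    ... | inj₁ (ss′ , len , u′ , origin) = inj₁ (s ∷ ss′ , cong suc len ,
      Unique.++⁺ (Spider.unique s) u′
        (λ (a , b) → [ (λ b → s∩ss=∅ (a , b)) , (λ v∉ → v∉ (Z⊆Z′ (sub (∈-++⁺ˡ a)))) ]′ (origin b)) ,
      λ v∈ → [ (λ v∈s → inj₁ (∈-++⁺ˡ v∈s)) ,
               (λ v∈ss → Sum.map (∈-++⁺ʳ (verts s)) (_∘ Z⊆Z′) (origin v∈ss)) ]′ (∈-++⁻ (verts s) v∈))
      where open Extend.Exhausted ex
    ... | inj₂ fam = inj₂ (record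
      { bundles = E.bundle ∷ F.bundles ; size = cong suc F.size ; Z′ = F.Z′
      ; Z⊆Z′ = λ v∈ → F.Z⊆Z′ (E.Z⊆Z′ v∈)
      ; isDead = IsDead-mono E.bundle F.Z⊆Z′ E.isDead ∷ F.isDead
      ; disjoint = All.tabulate (λ b∈ (x , y) → apart x (∈-concatMap⁺ O (Any.map (λ where refl → y) b∈))) ∷ F.disjoint
      ; Z′⊆ = λ v∈ → [ (λ v∈E → Sum.map id ∈-++⁺ˡ (E.Z′⊆ v∈E)) , inj₂ ∘ ∈-++⁺ʳ (O E.bundle) ]′ (F.Z′⊆ v∈)
      ; O-new = λ v∈ → [ (λ v∈E → Sum.map ∈-++⁺ˡ id (E.O-new v∈E)) ,
                         (λ v∈F → Sum.map (∈-++⁺ʳ (verts s)) (_∘ E.Z⊆Z′) (F.O-new v∈F)) ]′ (∈-++⁻ (O E.bundle) v∈)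
      ; ss⊆O = λ v∈ → [ ∈-++⁺ˡ ∘ E.sp⊆O , ∈-++⁺ʳ (O E.bundle) ∘ F.ss⊆O ]′ (∈-++⁻ (verts s) v∈)
      })
      where
      module E = Extend.Exhausted ex
      module F = DeadFamily fam
      apart : ∀ {v} → v ∈ O E.bundle → v ∉ concatMap O F.bundles
      apart v∈O v∈F with F.O-new v∈F
      ... | inj₂ v∉ = v∉ (E.O⊆Z′ v∈O)
      ... | inj₁ v∈ss with E.O-new v∈O
      ... | inj₁ v∈s = s∩ss=∅ (v∈s , v∈ss)
      ... | inj₂ v∉Z = v∉Z (sub (∈-++⁺ʳ (verts s) v∈ss))

    record ClosedFamily : Set where
      field
        bundles  : List Bundle
        nonempty : 0 < length bundles
        disjoint : AllPairs (λ b b′ → Disjoint (O b) (O b′)) bundles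
        isDead   : All (IsDead (concatMap O bundles)) bundles

    private
      length≤allVerts : ∀ ss → length ss ≤ length (allVerts ss)
      length≤allVerts [] = z≤n
      length≤allVerts (s ∷ ss) = s≤s (≤-trans (length≤allVerts ss)
        (≤-trans (m≤n+m _ (length (Spider.body s))) (≤-reflexive (sym (length-++ (Spider.body s))))))

      -- Disjoint spiders are at most as many as the vertices, so the enlarging ends.
      maximise : ∀ fuel ss → n D < fuel + length ss → 0 < length ss → Unique (allVerts ss) → ClosedFamily
      maximise zero ss lt _ u = contradiction
        (≤-trans (length≤allVerts ss) (unique-⊆⇒length≤ u (λ {v} _ → ∈-allFin v)))
        (<⇒≱ (subst (_< length ss) (sym (length-tabulate {n = n D} id)) lt))
      maximise (suc fuel) ss lt ne u with exhaust-all ss (allVerts ss) u id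
      ... | inj₁ (ss′ , len , u′ , _) = maximise fuel ss′
        (subst (n D <_) (trans (sym (+-suc fuel (length ss))) (cong (fuel +_) (sym len))) lt)
        (subst (0 <_) (sym len) (s≤s z≤n)) u′
      -- The used set started as the vertices of the family, so in the end it lies within the
      -- territories, and the tips are dead with respect to these.
      ... | inj₂ fam = record
        { bundles = bundles ; nonempty = subst (0 <_) (sym size) ne ; disjoint = disjoint
        ; isDead = All.map (λ {b} → IsDead-mono b ([ ss⊆O , id ]′ ∘ Z′⊆)) isDead }
        where open DeadFamily fam

    -- A first spider exists at `x`: a blocked attempt would confine all out-neighbours in `A` of
    -- some tip to at most `3m + 1` vertices.
    closed-family : Unique A → (∀ {v} → v ∈ A → suc (3 * m) < length (outA v)) →
                    ∀ {x} → x ∈ A → ClosedFamily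
    closed-family uA deg {x} x∈A with grow-legs 3 x [ x ]
    ... | g , fresh u s d , _ , inj₁ legs =
      maximise (n D) [ sp ] (subst (n D <_) (+-comm 1 (n D)) ≤-refl) (s≤s z≤n)
        (subst Unique (sym (++-identityʳ (verts sp))) (Spider.unique sp))
      where
      sp : Spider
      sp = spider legs ((All.tabulate λ where v∈ refl → d (v∈ , here refl)) ∷ u)
        λ where (here refl) → x∈A
                (there v∈) → s v∈
    ... | g , fresh u s d , le , inj₂ (blocked {l} {y} leg _ _ ⊆g dead) = contradiction
      (unique-⊆⇒length≤ (Unique.filter⁺ (y ⇒?_) uA) sub)
      (<⇒≱ (≤-trans (s≤s (≤-trans (≤-reflexive (trans (length-++ g) (+-comm _ 1))) (s≤s le))) (deg y∈A)))
      where
      y∈A : y ∈ A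
      y∈A with end∈leg leg
      ... | here refl = x∈A
      ... | there y∈l = s (⊆g y∈l)
      sub : outA y ⊆ g ++ [ x ]
      sub v∈ with v∈A , y⇒v ← ∈-filter⁻ (y ⇒?_) {xs = A} v∈ = dead y⇒v v∈A

lookup-apart : ∀ {a r} {X : Set a} {R : X → X → Set r} → (∀ {x y} → R x y → R y x) →
               ∀ {xs} → AllPairs R xs → ∀ i j → i ≢ j → R (lookup xs i) (lookup xs j)
lookup-apart R-sym (px ∷ pxs) zero zero ne = ⊥-elim (ne refl)
lookup-apart R-sym (px ∷ pxs) zero (suc j) ne = All.lookup px (∈-lookup j)
lookup-apart R-sym (px ∷ pxs) (suc i) zero ne = R-sym (All.lookup px (∈-lookup i))
lookup-apart R-sym (px ∷ pxs) (suc i) (suc j) ne = lookup-apart R-sym pxs i j (ne ∘ cong suc)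

-- Constants, and greedy chains of blocks through the spiders.

module Parameters (ℓ : ℕ) where
  -- `C` bounds a territory, `c₁` exceeds the size of `2ℓ + 1` territories, and `c₂` exceeds
  -- `2ℓ + 2`, the most spiders ever excluded at once. A tip with fewer than `c₁` rich
  -- out-neighbours still has `(ℓ + 1) C c₂` poor ones.
  legLen C c₁ c₂ K′ : ℕ
  legLen = ℓ + ℓ
  C = suc (12 * legLen)
  c₁ = suc (suc (2 * ℓ) * C)
  c₂ = suc (suc (suc (2 * ℓ)))
  K′ = c₁ + suc ℓ * (C * c₂)

  3-legs<K′ : suc (3 * legLen) < K′
  3-legs<K′ = ≤-trans (s≤s (s≤s (*-monoˡ-≤ legLen (m≤m+n 3 9))))
    (≤-trans (s≤s (m≤m+n C _)) (m≤m+n c₁ _))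

double< : ∀ {p ℓ} → p < ℓ → suc (p + p) ≤ ℓ + ℓ
double< {p} lt = +-mono-≤ lt (<⇒≤ lt)

module Chains (D : Digraph) (A : List (Fin (n D))) (A-unique : Unique A) (ℓ : ℕ)
  (outdeg≥ : ∀ {v} → v ∈ A → Parameters.K′ ℓ ≤ length (Growing.outA D A v))
  (0<legLen : 0 < Parameters.legLen ℓ)
  (family : Spiders.ClosedFamily D A (Parameters.legLen ℓ) 0<legLen)
  where

  open Walks D
  open Growing D A
  open Parameters ℓ
  open Spiders D A legLen
  open ClosedFamily family

  N : ℕ
  N = length bundles

  module B (i : Fin N) = Bundle (lookup bundles i)
  open B public using (O; center; leg; tip)

  allO : List V
  allO = concatMap Bundle.O bundles

  O-disjoint : ∀ {i j} → i ≢ j → Disjoint (O i) (O j)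
  O-disjoint {i} {j} = lookup-apart {R = λ b b′ → Disjoint (Bundle.O b) (Bundle.O b′)}
    (λ d (x , y) → d (y , x)) disjoint i j

  owner : ∀ {v} → v ∈ allO → ∃ λ i → v ∈ O i
  owner v∈ = Any.index v∈′ , lookup-index v∈′
    where v∈′ = ∈-concatMap⁻ Bundle.O {xs = bundles} v∈

  tip∈A : ∀ i a → tip i a ∈ A
  tip∈A i a = B.O⊆A i (B.leg⊆O i a (tip∈leg (B.isLeg i a) (≤-trans 0<legLen (B.long i a))))

  dead : ∀ i a {t} → tip i a ⇒ t → t ∈ A → t ∈ allO
  dead i = All.lookup isDead (∈-lookup i)

  -- An oriented path that leaves spider i along leg a, realises the given blocks except the last
  -- one, and ends with an uncut leg of another spider. Apart from leg a of spider i, it only meets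
  -- the territories of spiders outside i ∷ F.
  record Chain (i : Fin N) (a : Bool) (F : List (Fin N)) (q : ℕ) (ps : List (ℕ × ℕ)) : Set where
    field
      {mid}    : List Bool
      {q′}     : ℕ
      {s f}    : V
      {vs ls}  : List V
      word     : replicate (suc q) true ++ blocks ps ≡ mid ++ replicate (suc q′) true
      q′<ℓ     : q′ < ℓ
      real     : Real mid (center i) s vs
      last     : Leg s ls f
      long     : legLen ≤ length ls
      unique   : Unique (vs ++ s ∷ ls)
      within   : ∀ {v} → v ∈ vs ++ s ∷ ls → v ∈ center i ∷ leg i a ⊎ (∃ λ j → j ∉ i ∷ F × v ∈ O j)
      size     : length (vs ++ s ∷ ls) ≤ suc (2 * length ps) * suc (legLen + legLen)

  half⊆O : ∀ i a → center i ∷ leg i a ⊆ O i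
  half⊆O i a (here refl) = B.center∈O i
  half⊆O i a (there v∈) = B.leg⊆O i a v∈

  half-unique : ∀ i a → Unique (center i ∷ leg i a)
  half-unique i a = proj₁ (unique-++⁻ (center i ∷ leg i a) (B.unique i a))

  chain-base : ∀ i a F q → q < ℓ → Chain i a F q []
  chain-base i a F q q<ℓ = record
    { word = ++-identityʳ _ ; q′<ℓ = q<ℓ ; real = [] ; last = B.isLeg i a ; long = B.long i a
    ; unique = half-unique i a ; within = inj₁
    ; size = s≤s (≤-trans (B.short i a) (≤-reflexive (sym (+-identityʳ _)))) }

  -- The new path follows leg `a` to the sink `t`, goes back along leg `b` to the center of `i₂`,
  -- and leaves by the other leg. The pieces are disjoint because `i`, `j₀` and `i₂` are distinct
  -- and the rest of the chain avoids the territories of all three, apart from that other leg.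
  chain-step : ∀ {i a F q p q₂ ps t j₀ i₂ b} → q < ℓ → p < ℓ →
               tip i a ⇒ t → t ∈ O j₀ → j₀ ∉ i ∷ F → tip i₂ b ⇒ t → i₂ ∉ j₀ ∷ i ∷ F →
               Chain i₂ (not b) (j₀ ∷ i ∷ F) q₂ ps → Chain i a F q ((p , q₂) ∷ ps)
  chain-step {i} {a} {F} {q} {p} {q₂} {ps} {t} {j₀} {i₂} {b} q<ℓ p<ℓ i⇒t t∈ j₀∉ i₂⇒t i₂∉ ch
    with us , back , perm ← prepend-backward p (≤-trans (double< p<ℓ) (B.long i₂ b)) (B.isLeg i₂ b ▹ i₂⇒t) (Chain.real ch)
    = record
    { word = trans (cong (λ w → T ++ Fs ++ w) C.word)
        (trans (cong (T ++_) (sym (++-assoc Fs C.mid _))) (sym (++-assoc T (Fs ++ C.mid) _)))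
    ; q′<ℓ = C.q′<ℓ
    ; real = prepend-forward q (≤-trans (double< q<ℓ) (B.long i a)) (B.isLeg i a ▹ i⇒t) back
    ; last = C.last
    ; long = C.long
    ; unique = unique-↭ (↭-sym perm′) (Unique.++⁺ (half-unique i a) uniq₂ apart)
    ; within = λ v∈ → [ inj₁ , (λ v∈′ → inj₂ (elsewhere v∈′)) ]′ (∈-++⁻ H (∈-resp-↭ perm′ v∈))
    ; size = begin
        length ((H ++ us) ++ R₀) ≡⟨ ↭-length perm′ ⟩
        length (H ++ t ∷ lb ++ R) ≡⟨ trans (length-++ H) (cong (length H +_) (cong suc (length-++ lb))) ⟩
        length H + (suc (length lb) + length R)
          ≤⟨ +-mono-≤ (s≤s (B.short i a)) (+-mono-≤ (s≤s (B.short i₂ b)) C.size) ⟩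
        M + (M + suc (2 * length ps) * M) ≡⟨ lemma M (length ps) ⟩
        suc (2 * suc (length ps)) * M ∎
    }
    where
    open ≤-Reasoning
    module C = Chain ch
    M = suc (legLen + legLen)
    T = replicate (suc q) true
    Fs = replicate (suc p) false
    H = center i ∷ leg i a
    lb = leg i₂ b
    R₀ = C.s ∷ C.ls
    R = C.vs ++ R₀
    lemma : ∀ M k → M + (M + suc (2 * k) * M) ≡ suc (2 * suc k) * M
    lemma = solve-∀
    perm′ : (H ++ us) ++ R₀ ↭ H ++ t ∷ lb ++ R
    perm′ = ↭-trans (↭-reflexive (++-assoc H us R₀)) (++⁺ˡ H (↭-trans (++⁺ʳ R₀ perm)
      (prep t (↭-reflexive (++-assoc lb C.vs R₀)))))
    i₂≢j₀ : i₂ ≢ j₀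
    i₂≢j₀ = i₂∉ ∘ here
    R-within : ∀ {v} → v ∈ R → v ∈ center i₂ ∷ leg i₂ (not b) ⊎ (∃ λ j → j ∉ i₂ ∷ j₀ ∷ i ∷ F × v ∈ O j)
    R-within = C.within
    elsewhere : ∀ {v} → v ∈ t ∷ lb ++ R → ∃ λ j → j ∉ i ∷ F × v ∈ O j
    elsewhere (here refl) = j₀ , j₀∉ , t∈
    elsewhere (there v∈) with ∈-++⁻ lb v∈
    ... | inj₁ v∈lb = i₂ , i₂∉ ∘ there , B.leg⊆O i₂ b v∈lb
    ... | inj₂ v∈R with R-within v∈R
    ... | inj₁ v∈h = i₂ , i₂∉ ∘ there , half⊆O i₂ (not b) v∈h
    ... | inj₂ (j , j∉ , v∈j) = j , j∉ ∘ there ∘ there , v∈j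
    apart : Disjoint H (t ∷ lb ++ R)
    apart (v∈H , v∈) with j , j∉ , v∈j ← elsewhere v∈ =
      O-disjoint (j∉ ∘ here) (v∈j , half⊆O i a v∈H)
    t∉ : t ∉ lb ++ R
    t∉ v∈ with ∈-++⁻ lb v∈
    ... | inj₁ v∈lb = O-disjoint i₂≢j₀ (B.leg⊆O i₂ b v∈lb , t∈)
    ... | inj₂ v∈R with R-within v∈R
    ... | inj₁ v∈h = O-disjoint i₂≢j₀ (half⊆O i₂ (not b) v∈h , t∈)
    ... | inj₂ (j , j∉ , v∈j) = O-disjoint (j∉ ∘ there ∘ here) (v∈j , t∈)
    lb∩R=∅ : Disjoint lb R
    lb∩R=∅ (v∈lb , v∈R) with R-within v∈R
    ... | inj₂ (j , j∉ , v∈j) = O-disjoint (j∉ ∘ here) (v∈j , B.leg⊆O i₂ b v∈lb)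
    ... | inj₁ (here refl) = Unique.Unique[x∷xs]⇒x∉xs (half-unique i₂ b) v∈lb
    ... | inj₁ (there v∈l) = proj₂ (proj₂ (unique-++⁻ (center i₂ ∷ lb) (B.unique i₂ b))) (there v∈lb , v∈l)
    uniq₂ : Unique (t ∷ lb ++ R)
    uniq₂ = (All.tabulate λ where v∈ refl → t∉ v∈) ∷
      Unique.++⁺ (AllPairs.tail (half-unique i₂ b)) C.unique lb∩R=∅

  Adjacent : Fin N → V → Set
  Adjacent i t = ∃ λ a → tip i a ⇒ t

  adjacent? : ∀ i t → Dec (Adjacent i t)
  adjacent? i t with tip i true ⇒? t | tip i false ⇒? t
  ... | yes e | _ = yes (true , e)
  ... | no _ | yes e = yes (false , e)
  ... | no ¬e | no ¬e′ = no λ where (true , e) → ¬e e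
                                    (false , e) → ¬e′ e

  -- For all but few spiders, a chain through k further spiders can be built in any way avoiding
  -- the prescribed spiders F. A spider turns bad at the next level if many out-neighbours of one of
  -- its tips are poor, i.e. have few good in-neighbours; double counting arcs into poor vertices
  -- bounds the number of such spiders.
  record Level (k : ℕ) : Set where
    field
      bad   : List (Fin N)
      few   : length bad * suc ℓ ≤ k * N
      chain : ∀ {i} → i ∉ bad → ∀ a F q ps → length ps ≡ k → length F + 2 * k ≤ 2 * ℓ →
              q < ℓ → All (Short ℓ) ps → Chain i a F q ps

  module Raise {k : ℕ} (L : Level k) where
    open Level L
    open DecMembership (Fin._≟_ {N}) using () renaming (_∈?_ to _∈ᴵ?_)

    good-neighbour? : ∀ t i → Dec (Adjacent i t × i ∉ bad)
    good-neighbour? t i = adjacent? i t ×-dec ¬? (i ∈ᴵ? bad)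

    good-neighbours : V → List (Fin N)
    good-neighbours t = filter (good-neighbour? t) (allFin N)

    Rich : V → Set
    Rich t = c₂ ≤ length (good-neighbours t)

    rich? : ∀ t → Dec (Rich t)
    rich? t = c₂ ≤? length (good-neighbours t)

    Poor : Fin N → Set
    Poor i = ∃ λ a → length (filter rich? (outA (tip i a))) < c₁

    poor? : ∀ i → Dec (Poor i)
    poor? i with length (filter rich? (outA (tip i true))) <? c₁ | length (filter rich? (outA (tip i false))) <? c₁
    ... | yes lt | _ = yes (true , lt)
    ... | no _ | yes lt = yes (false , lt)
    ... | no ¬lt | no ¬lt′ = no λ where (true , lt) → ¬lt lt
                                        (false , lt) → ¬lt′ lt

    new? : ∀ i → Dec (Poor i × i ∉ bad)
    new? i = poor? i ×-dec ¬? (i ∈ᴵ? bad)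

    new : List (Fin N)
    new = filter new? (allFin N)

    edge? : ∀ i t → Dec (Adjacent i t × ¬ Rich t)
    edge? i t = adjacent? i t ×-dec ¬? (rich? t)

    -- Fewer than `c₁` of the `K′` or more out-neighbours of some tip are rich; the others are poor
    -- and, the tip being dead, lie in the territories.
    many : ∀ {i} → i ∈ new → suc ℓ * (C * c₂) ≤ length (filter (edge? i) allO)
    many {i} i∈ with (a , lt) , _ ← proj₂ (∈-filter⁻ new? {xs = allFin N} i∈) = ≤-trans
      (+-cancelˡ-≤ c₁ _ _ (begin
        c₁ + suc ℓ * (C * c₂) ≤⟨ outdeg≥ (tip∈A i a) ⟩
        length outs ≡⟨ sym (length-filter-∁ rich? outs) ⟩
        length (filter rich? outs) + length poors ≤⟨ +-monoˡ-≤ (length poors) (<⇒≤ lt) ⟩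
        c₁ + length poors ∎))
      (unique-⊆⇒length≤ (Unique.filter⁺ (¬? ∘ rich?) (Unique.filter⁺ (tip i a ⇒?_) A-unique)) sub)
      where
      open ≤-Reasoning
      outs = outA (tip i a)
      poors = filter (¬? ∘ rich?) outs
      sub : poors ⊆ filter (edge? i) allO
      sub t∈ with t∈outs , ¬rich ← ∈-filter⁻ (¬? ∘ rich?) {xs = outs} t∈
             with t∈A , e ← ∈-filter⁻ (tip i a ⇒?_) {xs = A} t∈outs =
        ∈-filter⁺ (edge? i) (dead i a e t∈A) ((a , e) , ¬rich)

    -- Newly bad spiders are still good at level `k`, so those adjacent to a poor `t` are among its
    -- fewer than `c₂` good in-neighbours. A rich `t` contributes nothing.
    limited : ∀ t → length (filter (λ i → edge? i t) new) ≤ c₂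
    limited t = bound (rich? t)
      where
      unique : Unique (filter (λ i → edge? i t) new)
      unique = Unique.filter⁺ (λ i → edge? i t) (Unique.filter⁺ new? (Unique.allFin⁺ N))
      edges : ∀ {i} → i ∈ filter (λ i → edge? i t) new → i ∈ new × Adjacent i t × ¬ Rich t
      edges = ∈-filter⁻ (λ i → edge? i t) {xs = new}
      sub : filter (λ i → edge? i t) new ⊆ good-neighbours t
      sub i∈ with i∈new , adj , _ ← edges i∈ =
        ∈-filter⁺ (good-neighbour? t) (∈-allFin _) (adj , proj₂ (proj₂ (∈-filter⁻ new? {xs = allFin N} i∈new)))
      bound : Dec (Rich t) → length (filter (λ i → edge? i t) new) ≤ c₂
      bound (yes r) = ≤-trans (unique-⊆⇒length≤ {ys = []} unique λ i∈ → ⊥-elim (proj₂ (proj₂ (edges i∈)) r)) z≤n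
      bound (no ¬r) = ≤-trans (unique-⊆⇒length≤ unique sub) (<⇒≤ (≰⇒> ¬r))

    new-few : length new * suc ℓ ≤ N
    new-few = *-cancelʳ-≤ _ _ (C * c₂) (begin
      length new * suc ℓ * (C * c₂) ≡⟨ *-assoc (length new) (suc ℓ) (C * c₂) ⟩
      length new * (suc ℓ * (C * c₂)) ≤⟨ double-count edge? new allO many (λ {t} _ → limited t) ⟩
      length allO * c₂ ≤⟨ *-monoˡ-≤ c₂ (lengths-concatMap Bundle.O C Bundle.O-small bundles) ⟩
      N * C * c₂ ≡⟨ *-assoc N C c₂ ⟩
      N * (C * c₂) ∎)
      where open ≤-Reasoning

    enough : ∀ {i} → i ∉ new ++ bad → ∀ a → c₁ ≤ length (filter rich? (outA (tip i a)))
    enough {i} i∉ a =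
      ≮⇒≥ λ lt → i∉ (∈-++⁺ˡ (∈-filter⁺ new? (∈-allFin i) ((a , lt) , i∉ ∘ ∈-++⁺ʳ new)))

    extend : ∀ {i} → i ∉ new ++ bad → ∀ a F q ps → length ps ≡ suc k → length F + 2 * suc k ≤ 2 * ℓ →
             q < ℓ → All (Short ℓ) ps → Chain i a F q ps
    extend {i} i∉ a F q ((p , q₂) ∷ ps) refl room q<ℓ (short ∷ shorts)
      -- The next sink: `i ∷ F` has at most `2ℓ + 1` entries, whose territories hold fewer than `c₁`
      -- vertices.
      with t , t∈rich , t∉ ← pick-∉ Fin._≟_ {ys = concatMap O (i ∷ F)}
             (Unique.filter⁺ rich? (Unique.filter⁺ (tip i a ⇒?_) A-unique))
             (≤-trans (s≤s (≤-trans (lengths-concatMap O C B.O-small (i ∷ F))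
               (*-monoˡ-≤ C (s≤s (≤-trans (m≤m+n (length F) _) room))))) (enough i∉ a))
      with t∈outs , rich ← ∈-filter⁻ rich? {xs = outA (tip i a)} t∈rich
      with t∈A , i⇒t ← ∈-filter⁻ (tip i a ⇒?_) {xs = A} t∈outs
      with j₀ , t∈j₀ ← owner (dead i a i⇒t t∈A)
      -- The next source: `t` has `c₂` good in-neighbours, and at most `2ℓ + 2` spiders are
      -- excluded.
      with i₂ , i₂∈ , i₂∉ ← pick-∉ Fin._≟_ {ys = j₀ ∷ i ∷ F}
             (Unique.filter⁺ (good-neighbour? t) (Unique.allFin⁺ N))
             (≤-trans (s≤s (s≤s (s≤s (≤-trans (m≤m+n (length F) _) room)))) rich)
      with (b , i₂⇒t) , i₂-good ← proj₂ (∈-filter⁻ (good-neighbour? t) {xs = allFin N} i₂∈) =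
      chain-step q<ℓ (Short.fst< short) i⇒t t∈j₀
        (λ j₀∈ → t∉ (∈-concatMap⁺ O (Any.map (λ where refl → t∈j₀) j₀∈)))
        i₂⇒t i₂∉
        (chain i₂-good (not b) (j₀ ∷ i ∷ F) q₂ ps refl room′ (Short.snd< short) shorts)
      where
      -- One step excludes two more spiders and uses up one pair.
      room′ : suc (suc (length F)) + 2 * length ps ≤ 2 * ℓ
      room′ = ≤-trans (≤-reflexive (lemma (length F) (length ps))) room
        where
        lemma : ∀ a b → suc (suc a) + 2 * b ≡ a + 2 * suc b
        lemma = solve-∀

    raised : Level (suc k)
    raised = record
      { bad = new ++ bad
      ; few = begin
          length (new ++ bad) * suc ℓ ≡⟨ cong (_* suc ℓ) (length-++ new) ⟩
          (length new + length bad) * suc ℓ ≡⟨ *-distribʳ-+ (suc ℓ) (length new) (length bad) ⟩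
          length new * suc ℓ + length bad * suc ℓ ≤⟨ +-mono-≤ new-few few ⟩
          N + k * N ∎
      ; chain = extend }
      where open ≤-Reasoning

  level : ∀ k → Level k
  level zero = record { bad = [] ; few = z≤n ; chain = λ where _ a F q [] refl _ q<ℓ _ → chain-base _ a F q q<ℓ }
  level (suc k) = Raise.raised (level k)

  -- The bad spiders make up at most the fraction `k / (ℓ + 1)`, which is less than one.
  few-bad : ∀ {k} (L : Level k) → k ≤ ℓ → length (Level.bad L) < N
  few-bad {k} L le = *-cancelʳ-< (suc ℓ) (length bad) N (begin-strict
    length bad * suc ℓ ≤⟨ few ⟩
    k * N ≤⟨ *-monoˡ-≤ N le ⟩
    ℓ * N <⟨ +-monoˡ-≤ (ℓ * N) nonempty ⟩
    N + ℓ * N ≡⟨ *-comm (suc ℓ) N ⟩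
    N * suc ℓ ∎)
    where
    open Level L
    open ≤-Reasoning

  find-chain : ∀ q ps → length ps ≤ ℓ → q < ℓ → All (Short ℓ) ps → ∃ λ i → Chain i true [] q ps
  find-chain q ps le q<ℓ shorts
    with i , _ , i∉ ← pick-∉ Fin._≟_ (Unique.allFin⁺ N)
           (subst (length (Level.bad (level (length ps))) <_) (sym (length-tabulate {n = N} id))
             (few-bad (level (length ps)) le)) =
    i , Level.chain (level (length ps)) i∉ true [] q ps refl (*-monoʳ-≤ 2 le) q<ℓ shorts

-- Degrees within a set, and constant orientations.

module Degrees (D : Digraph) where
  open Walks D

  -- At most `w` out-neighbours are lost to `B`.
  outA-large : ∀ {A B w k} → (∀ v → w + k ≤ outdeg D v) → length B ≤ w →
               (∀ {u v} → u ∈ A → u ⇒ v → v ∈ A ⊎ v ∈ B) →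
               ∀ {v} → v ∈ A → k ≤ length (Growing.outA D A v)
  outA-large {A} {B} {w} {k} deg B≤ closed {v} v∈A = +-cancelˡ-≤ w _ _ (begin
    w + k ≤⟨ deg v ⟩
    length (filterᵇ (arc D v) (allFin (n D)))
      ≤⟨ unique-⊆⇒length≤ (Unique.filter⁺ (Bool.T? ∘ arc D v) (Unique.allFin⁺ (n D))) sub ⟩
    length (B ++ outA v) ≡⟨ length-++ B ⟩
    length B + length (outA v) ≤⟨ +-monoˡ-≤ _ B≤ ⟩
    w + length (outA v) ∎)
    where
    open ≤-Reasoning
    open Growing D A using (outA)
    sub : filterᵇ (arc D v) (allFin (n D)) ⊆ B ++ outA v
    sub u∈ with v⇒u ← Equivalence.to T-≡ (proj₂ (∈-filter⁻ (Bool.T? ∘ arc D v) {xs = allFin (n D)} u∈))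
           with closed v∈A v⇒u
    ... | inj₁ u∈A = ∈-++⁺ʳ B (∈-filter⁺ (v ⇒?_) u∈A v⇒u)
    ... | inj₂ u∈B = ∈-++⁺ˡ u∈B

  realise-constant : ∀ ℓ b {c is} → 0 < ℓ → ℓ + ℓ ≤ suc (length is) → Walk c is c → Unique (c ∷ is) →
                     ∃ λ us → Real (replicate ℓ b) c c us × Unique us
  realise-constant (suc p) true {c} {is} _ (s≤s le) w u =
    _ , subst (λ bs → Real bs c c (c ∷ is ++ [])) (++-identityʳ _)
          (prepend-forward p (subst (_≤ length is) (+-suc p p) le) w []) ,
    subst (Unique ∘ (c ∷_)) (sym (++-identityʳ is)) u
  realise-constant (suc p) false {c} {is} _ (s≤s le) w u
    with us , r , perm ← prepend-backward p (subst (_≤ length is) (+-suc p p) le) w [] =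
    us , subst (λ bs → Real bs c c us) (++-identityʳ _) r ,
    unique-↭ (↭-sym (↭-trans perm (prep c (↭-reflexive (++-identityʳ is))))) u

-- Closing the cycle, or descending to a smaller set.

module Closing (D : Digraph) (ℓ : ℕ) (p q : ℕ) (ps : List (ℕ × ℕ))
               (word-short : length (blocks ((p , q) ∷ ps)) ≤ ℓ) where
  open Walks D
  open Parameters ℓ

  -- Bounds `W`, made of at most `2ℓ` legs with one further vertex each. The boundary `B` may be
  -- twice as large, to hold both `W` and half of the previous boundary.
  half : ℕ
  half = 2 * ℓ * suc (legLen + legLen)

  private
    shorts : All (Short ℓ) ((p , q) ∷ ps)
    shorts = blocks-short ((p , q) ∷ ps) word-short

    p<ℓ : p < ℓ
    p<ℓ = Short.fst< (All.head shorts)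

    q<ℓ : q < ℓ
    q<ℓ = Short.snd< (All.head shorts)

    ps<ℓ : length ps < ℓ
    ps<ℓ = ≤-trans (length≤blocks ((p , q) ∷ ps)) word-short

    0<legLen : 0 < legLen
    0<legLen = ≤-trans (s≤s z≤n) (double< p<ℓ)

  Closed : Set
  Closed = ∃₂ λ z vs → Real (blocks ((p , q) ∷ ps)) z z vs × Unique vs

  module _ (A : List V) (A-unique : Unique A)
           (outdeg≥ : ∀ {v} → v ∈ A → K′ ≤ length (Growing.outA D A v))
           (family : Spiders.ClosedFamily D A legLen 0<legLen) where
    open Chains D A A-unique ℓ outdeg≥ 0<legLen family

    module Merge {i : Fin N} (ch : Chain i true [] q ps) where
      open Chain ch using (s; f; vs; ls; mid; q′)
      open Reaching D using (module Reach; reach)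
      private module C = Chain ch

      e : V
      e = tip i false

      le W : List V
      le = leg i false
      W = le ++ vs ++ s ∷ ls

      e∈le : e ∈ le
      e∈le = tip∈leg (B.isLeg i false) (≤-trans 0<legLen (B.long i false))

      f∈rest : f ∈ vs ++ s ∷ ls
      f∈rest = ∈-++⁺ʳ vs (end∈leg C.last)

      e∈W : e ∈ W
      e∈W = ∈-++⁺ˡ e∈le

      f∈W : f ∈ W
      f∈W = ∈-++⁺ʳ le f∈rest

      le-apart : Disjoint le (vs ++ s ∷ ls)
      le-apart (v∈le , v∈) with C.within v∈
      ... | inj₂ (j , j∉ , v∈j) = O-disjoint (j∉ ∘ here) (v∈j , B.leg⊆O i false v∈le)
      ... | inj₁ (here refl) = Unique.Unique[x∷xs]⇒x∉xs (half-unique i false) v∈le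
      ... | inj₁ (there v∈l) = proj₂ (proj₂ (unique-++⁻ (center i ∷ le) (B.unique i false))) (there v∈le , v∈l)

      W-unique : Unique W
      W-unique = Unique.++⁺ (proj₁ (proj₂ (unique-++⁻ [ center i ] (half-unique i false)))) C.unique le-apart

      f∈A : f ∈ A
      f∈A with C.within f∈rest
      ... | inj₁ f∈h = B.O⊆A i (half⊆O i true f∈h)
      ... | inj₂ (j , _ , f∈j) = B.O⊆A j f∈j

      e≢f : e ≢ f
      e≢f eq = le-apart (e∈le , subst (_∈ _) (sym eq) f∈rest)

      W-small : length W ≤ half
      W-small = begin
        length W ≡⟨ length-++ le ⟩
        length le + length (vs ++ s ∷ ls) ≤⟨ +-mono-≤ (m≤n⇒m≤1+n (B.short i false)) C.size ⟩
        M + suc (2 * length ps) * M ≡⟨ lemma M (length ps) ⟩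
        2 * suc (length ps) * M ≤⟨ *-monoˡ-≤ M (*-monoʳ-≤ 2 ps<ℓ) ⟩
        half ∎
        where
        open ≤-Reasoning
        M = suc (legLen + legLen)
        lemma : ∀ M k → M + suc (2 * k) * M ≡ 2 * suc k * M
        lemma = solve-∀

      module Rf = Reach W f (reach W f)
      -- Forbidding also what `f` reaches makes the two sets disjoint; paths from `e` and `f` can
      -- then meet only by an arc from the first set into the second.
      module Re = Reach (W ++ Rf.R) e (reach (W ++ Rf.R) e)

      Re∩Rf=∅ : ∀ {v} → v ∈ Re.R → v ∉ Rf.R
      Re∩Rf=∅ v∈e v∈f with l , leg-e , _ , avoid ← Re.reached v∈e with end∈leg leg-e
      ... | there v∈l = proj₂ (avoid v∈l) (∈-++⁺ʳ W v∈f)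
      ... | here refl with l′ , leg-f , _ , avoid′ ← Rf.reached v∈f with end∈leg leg-f
      ... | here eq = e≢f eq
      ... | there e∈l′ = proj₂ (avoid′ e∈l′) e∈W

      e∉Rf : e ∉ Rf.R
      e∉Rf = Re∩Rf=∅ Re.e∈R

      f∉Re : f ∉ Re.R
      f∉Re f∈ = Re∩Rf=∅ f∈ Rf.e∈R

      -- `z` becomes the missing sink. The cycle runs backward from `z` through `u` and `e` to the
      -- center of `i`, along the chain to `s`, and forward through `f` to `z`. As `z ≢ f`, the
      -- vertex `z` lies outside `W`.
      close : ∀ {u z} → u ∈ Re.R → z ∈ Rf.R → u ⇒ z → z ≢ f → Closed
      close {u} {z} u∈ z∈ u⇒z z≢f
        with l , leg-e , _ ∷ l-unique , avoid ← Re.reached u∈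
        with l′ , leg-f , _ ∷ l′-unique , avoid′ ← Rf.reached z∈
        with js , refl , walk-f ← unsnocᴸ leg-f (z≢f ∘ sym)
        with us , real , perm ← prepend-backward p
               (≤-trans (double< p<ℓ) (≤-trans (B.long i false)
                 (≤-trans (m≤m+n _ _) (≤-reflexive (sym (length-++ le {l}))))))
               ((B.isLeg i false ++ᴸ leg-e) ▹ u⇒z)
               (C.real ++ᴿ prepend-forward q′
                 (≤-trans (double< C.q′<ℓ) (≤-trans C.long
                   (≤-trans (m≤m+n _ _) (≤-reflexive (sym (length-++ ls {js}))))))
                 (C.last ++ᵂ walk-f) [])
        = z , us ,
          subst (λ w → Real w z z us)
            (cong (replicate (suc p) false ++_) (trans (cong (mid ++_) (++-identityʳ _)) (sym C.word))) real ,
          unique-↭ (↭-sym (↭-trans perm perm′)) all-unique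
        where
        perm′ : z ∷ (le ++ l) ++ vs ++ (s ∷ ls ++ js) ++ [] ↭ W ++ l ++ js ++ [ z ]
        perm′ = solve 6 (λ z le l vs sls js → z ⊕ ((le ⊕ l) ⊕ (vs ⊕ ((sls ⊕ js) ⊕ ε)))
                                             ⊜ (le ⊕ (vs ⊕ sls)) ⊕ (l ⊕ (js ⊕ z)))
                  ↭-refl [ z ] le l vs (s ∷ ls) js
          where
          open Algebra.Solver.CommutativeMonoid (++-commutativeMonoid {A = V})
            using (solve; _⊕_; _⊜_) renaming (id to ε)
        all-unique : Unique (W ++ l ++ js ++ [ z ])
        all-unique = Unique.++⁺ W-unique
          (Unique.++⁺ l-unique l′-unique λ (a , b) → Re∩Rf=∅ (proj₁ (avoid a)) (proj₁ (avoid′ b)))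
          λ (a , b) → [ (λ b∈l → proj₂ (avoid b∈l) (∈-++⁺ˡ a)) , (λ b∈l′ → proj₂ (avoid′ b∈l′) a) ]′ (∈-++⁻ l b)

      NoEntry : Set
      NoEntry = ∀ {u z} → u ∈ Re.R → z ∈ Rf.R → u ⇒ z → z ≡ f

      close? : Closed ⊎ NoEntry
      close? with Any.any? (λ u → Any.any? (λ z → (u ⇒? z) ×-dec ¬? (z Fin.≟ f)) Rf.R) Re.R
      ... | yes some with u , u∈ , some′ ← find some with z , z∈ , u⇒z , z≢f ← find some′ =
        inj₁ (close u∈ z∈ u⇒z z≢f)
      ... | no none = inj₂ entry
        where
        entry : NoEntry
        entry {u} {z} u∈ z∈ u⇒z with z Fin.≟ f
        ... | yes eq = eq
        ... | no ne = ⊥-elim (none (Any.map (λ where refl → Any.map (λ where refl → u⇒z , ne) z∈) u∈))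

      -- The only vertex of `Rf.R` that an arc can enter is `f`, which belongs to `W`.
      Re-closed : NoEntry → ∀ {u v} → u ∈ Re.R → u ⇒ v → v ∈ Re.R ⊎ v ∈ W
      Re-closed entry u∈ u⇒v with Re.closed u∈ u⇒v
      ... | inj₁ v∈ = inj₁ v∈
      ... | inj₂ v∈ with ∈-++⁻ W v∈
      ... | inj₁ v∈W = inj₂ v∈W
      ... | inj₂ v∈f with refl ← entry u∈ v∈f u⇒v = inj₂ f∈W

  one-half : ∀ {a b h} → a + b ≤ h + h → a ≤ h ⊎ b ≤ h
  one-half {a} {b} {h} le with a ≤? h
  ... | yes a≤h = inj₁ a≤h
  ... | no a≰h = inj₂ (+-cancelˡ-≤ h b h (≤-trans (+-monoˡ-≤ b (<⇒≤ (≰⇒> a≰h))) le))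

  -- An arc leaving `R` ends in `W`, and an arc within `R` can leave `A` only into `B`.
  restrict-closed : ∀ {A B R W : List V} → (∀ {u v} → u ∈ A → u ⇒ v → v ∈ A ⊎ v ∈ B) →
                    (∀ {u v} → u ∈ R → u ⇒ v → v ∈ R ⊎ v ∈ W) →
                    ∀ {u v} → u ∈ filter (_∈? R) A → u ⇒ v →
                    v ∈ filter (_∈? R) A ⊎ v ∈ W ++ filter (_∈? R) B
  restrict-closed {A} {B} {R} {W} A-closed R-closed u∈ u⇒v
    with u∈A , u∈R ← ∈-filter⁻ (_∈? R) {xs = A} u∈
    with R-closed u∈R u⇒v | A-closed u∈A u⇒v
  ... | inj₂ v∈W | _ = inj₂ (∈-++⁺ˡ v∈W)
  ... | inj₁ v∈R | inj₁ v∈A = inj₁ (∈-filter⁺ (_∈? R) v∈A v∈R)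
  ... | inj₁ v∈R | inj₂ v∈B = inj₂ (∈-++⁺ʳ W (∈-filter⁺ (_∈? R) v∈B v∈R))

  find-closed : (∀ v → half + half + K′ ≤ outdeg D v) →
                ∀ fuel A B → length A ≤ fuel → Unique A → ∀ {x} → x ∈ A → length B ≤ half + half →
                (∀ {u v} → u ∈ A → u ⇒ v → v ∈ A ⊎ v ∈ B) → Closed
  find-closed deg zero [] B _ _ ()
  find-closed deg (suc fuel) A B A≤ uA x∈A B≤ A-closed = conclude M.close?
    where
    outdeg≥ : ∀ {v} → v ∈ A → K′ ≤ length (Growing.outA D A v)
    outdeg≥ = Degrees.outA-large D deg B≤ A-closed
    family : Spiders.ClosedFamily D A legLen 0<legLen
    family = Spiders.closed-family D A legLen 0<legLen uA
      (λ v∈A → ≤-trans 3-legs<K′ (outdeg≥ v∈A)) x∈A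
    found = Chains.find-chain D A uA ℓ outdeg≥ 0<legLen family q ps (<⇒≤ ps<ℓ) q<ℓ (All.tail shorts)
    module M = Merge A uA outdeg≥ family (proj₂ found)
    e∈A : M.e ∈ A
    e∈A = Chains.tip∈A D A uA ℓ outdeg≥ 0<legLen family (proj₁ found) false
    descend : ∀ R → (∀ {u v} → u ∈ R → u ⇒ v → v ∈ R ⊎ v ∈ M.W) →
              ∀ {y} → y ∈ A → y ∈ R → ∀ {y′} → y′ ∈ A → y′ ∉ R →
              length (filter (_∈? R) B) ≤ half → Closed
    descend R R-closed y∈A y∈R y′∈A y′∉R le =
      find-closed deg fuel (filter (_∈? R) A) (M.W ++ filter (_∈? R) B)
        -- The new set misses `y′`, so it is strictly smaller and the fuel suffices.
        (≤-pred (≤-trans (filter-notAll (_∈? R) A (Any.map (λ where refl → y′∉R) y′∈A)) A≤))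
        (Unique.filter⁺ (_∈? R) uA)
        (∈-filter⁺ (_∈? R) y∈A y∈R)
        (≤-trans (≤-reflexive (length-++ M.W)) (+-mono-≤ M.W-small le))
        (restrict-closed A-closed R-closed)
    conclude : Closed ⊎ M.NoEntry → Closed
    conclude (inj₁ c) = c
    conclude (inj₂ entry)
      -- The two reached sets share no vertex of `B`, so one of them meets at most `half` of it.
      -- Keeping the side of `e` drops `f`, and conversely.
      with one-half (≤-trans (length-filter-disjoint (_∈? M.Re.R) (_∈? M.Rf.R) M.Re∩Rf=∅ B) B≤)
    ... | inj₁ le = descend M.Re.R (M.Re-closed entry) e∈A M.Re.e∈R M.f∈A M.f∉Re le
    ... | inj₂ le = descend M.Rf.R M.Rf.closed M.f∈A M.Rf.e∈R e∈A M.e∉Rf le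

-- The polynomial bound and the theorem.

degree-bound : ℕ → ℕ
degree-bound ℓ = 2 * ℓ * suc (legLen + legLen) + 2 * ℓ * suc (legLen + legLen) + K′
  where open Parameters ℓ

-- The expansion of `degree-bound`, constant term first.
coefficients : List ℕ
coefficients = 5 ∷ 107 ∷ 186 ∷ 48 ∷ []

eval-coefficients : ∀ ℓ → evalPoly coefficients ℓ ≡ degree-bound ℓ
eval-coefficients = expand
  where
  expand : ∀ ℓ → 5 + ℓ * (107 + ℓ * (186 + ℓ * (48 + ℓ * 0))) ≡
    2 * ℓ * suc (ℓ + ℓ + (ℓ + ℓ)) + 2 * ℓ * suc (ℓ + ℓ + (ℓ + ℓ)) +
    (suc (suc (2 * ℓ) * suc (12 * (ℓ + ℓ))) + suc ℓ * (suc (12 * (ℓ + ℓ)) * suc (suc (suc (2 * ℓ)))))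
  expand = solve-∀

module _ (ℓ : ℕ) (2≤ℓ : 2 ≤ ℓ) (D : Digraph) (0<n : 0 < n D) (deg : ∀ v → degree-bound ℓ ≤ outdeg D v)
         (o : Fin ℓ → Bool) where
  open Walks D
  open Parameters ℓ

  private
    full : ∀ {u v : V} → u ∈ allFin (n D) → u ⇒ v → v ∈ allFin (n D) ⊎ v ∈ []
    full {v = v} _ _ = inj₁ (∈-allFin v)

    x : V
    x = Fin.fromℕ< 0<n

    2ℓ≤bound : ℓ + ℓ ≤ degree-bound ℓ
    2ℓ≤bound = begin
      ℓ + ℓ ≡⟨ cong (ℓ +_) (sym (+-identityʳ ℓ)) ⟩
      2 * ℓ ≤⟨ m≤m*n (2 * ℓ) (suc (legLen + legLen)) ⟩
      2 * ℓ * suc (legLen + legLen) ≤⟨ ≤-trans (m≤m+n _ _) (m≤m+n _ _) ⟩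
      degree-bound ℓ ∎
      where open ≤-Reasoning

  constant-case : ∀ b → tabulate o ≡ replicate ℓ b → ContainsSubdivision D (orientedCycle ℓ o)
  constant-case b eq
    with c , is , w , u , long ← Growing.long-cycle D (allFin (n D)) (Unique.allFin⁺ (n D))
           (≤-trans (≤-trans (s≤s z≤n) 2≤ℓ) (≤-trans (m≤m+n ℓ ℓ) 2ℓ≤bound))
           (Degrees.outA-large D {w = 0} deg (z≤n {0}) full) (∈-allFin x)
    with us , r , u′ ← Degrees.realise-constant D ℓ b (≤-trans (s≤s z≤n) 2≤ℓ) (≤-trans 2ℓ≤bound long) w u =
    closed⇒subdivision 2≤ℓ o (subst (λ bs → Real bs c c us) (sym eq) r) u′

  oriented-cycle : ContainsSubdivision D (orientedCycle ℓ o)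
  oriented-cycle with shape (tabulate o)
  ... | constant b eq = constant-case b (trans eq (cong (λ k → replicate k b) (length-tabulate o)))
  ... | alternating xs ys (p , q) ps eq eq′
    -- The descent starts from all vertices with empty boundary.
    with z , vs , real , uniq ← Closing.find-closed D ℓ p q ps
           (≤-reflexive (trans (cong length (sym eq′)) (trans (↭-length (++-comm ys xs))
             (trans (cong length (sym eq)) (length-tabulate o)))))
           deg (length (allFin (n D))) (allFin (n D)) [] ≤-refl (Unique.allFin⁺ (n D)) (∈-allFin x) z≤n full
    -- The block form is rotated back to the given orientation.
    with z′ , vs′ , real′ , uniq′ ← rotateᴿ ys xs (subst (λ w → Real w z z vs) (sym eq′) real) uniq =
    closed⇒subdivision 2≤ℓ o (subst (λ w → Real w z′ z′ vs′) (sym eq) real′) uniq′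

theorem1p6 : ∃[ cs ] (∀ (ℓ : ℕ) → 2 ≤ ℓ → ∀ (D : Digraph) → 0 < n D →
    minOutDeg≥ D (evalPoly cs ℓ) →
    ∀ (o : Fin ℓ → Bool) → ContainsSubdivision D (orientedCycle ℓ o))
theorem1p6 = coefficients , λ ℓ 2≤ℓ D 0<n deg →
  oriented-cycle ℓ 2≤ℓ D 0<n (λ v → subst (_≤ outdeg D v) (eval-coefficients ℓ) (deg v))
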